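{- Let $G_1$ be an $r_1$-regular graph with $n_1$ vertices and $m_1$ edges and let $G_2$ be an arbitrary graph with $n_2$ vertices. Then the Laplacian characteristic polynomial of the central edge neighborhood corona $G_1\underline{\boxdot}G_2$ is $$\begin{aligned}f(L(G_1\underline{\boxdot}G_2),x)=\;&(x-2)^{m_1-n_1}\Big[x^2-x(n_2r_1+r_1+2)\Big]\prod_{j=1}^{n_2}\big(x-1-\mu_j(G_2)\big)^{m_1}\\&\times\prod_{i=2}^{n_1}\Big[x^2-x\big(2+n_1+n_2r_1+\lambda_i(G_1)\big)+2n_1+n_2r_1-r_1+\lambda_i(G_1)-n_2\lambda_i(G_1)\Big].\end{aligned}$$
   Context: All graphs are simple and connected. For a graph $G$ on $n$ vertices, $A(G)$ is its adjacency matrix with eigenvalues $\lambda_1(G)\ge\dots\ge\lambda_n(G)$; $D(G)$ is the diagonal matrix of vertex degrees; $L(G)=D(G)-A(G)$ is the Laplacian matrix with eigenvalues $0=\mu_1(G)<\mu_2(G)\le\dots\le\mu_n(G)$. For an $n\times n$ matrix $M$, $f(M,x)=\det(xI_n-M)$, where $I_n$ is the identity matrix of order $n$. The central graph $C(G)$ of $G$ is obtained from $G$ by subdividing each edge of $G$ exactly once and joining all pairs of distinct vertices of $G$ that are nonadjacent in $G$; $\tilde V(G)=V(C(G))\setminus V(G)$ is the set of subdivision vertices, corresponding to the edges of $G$. The central edge neighborhood corona $G_1\underline{\boxdot}G_2$ is obtained by taking $C(G_1)$ and $|\tilde V(G_1)|$ copies of $G_2$, and joining the neighbors in $C(G_1)$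 of the $i$-th vertex of $\tilde V(G_1)$ to every vertex in the $i$-th copy of $G_2$, for each $i$.
   Formalization: The factor (x-1-μ_j(G_2))^{m_1} is corrected to (x-2-μ_j(G_2))^{m_1}: as printed the formula fails for G_1=K_2, G_2=K_1, whose corona is the 4-cycle with Laplacian polynomial x(x-2)^2(x-4). -}

module Defs where

open import Algebra.Apartness.Bundles using (HeytingField; HeytingCommutativeRing)
open import Algebra.Bundles using (CommutativeRing; Semiring)
import Algebra.Definitions.RawSemiring as RawSemiringDefs
open import Data.Bool.Base using (Bool; true; false; not; _∧_; _∨_; if_then_else_; T)
open import Data.Bool.Properties using (∧-zeroʳ)
open import Data.Fin.Base as Fin using (Fin; zero; suc; toℕ; punchIn; splitAt; remQuot)
open import Data.Fin.Properties using (_≟_; _<?_)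
open import Data.Fin.Subset using (Subset; ∣_∣)
open import Data.Integer.Base using (ℤ; +_; -[1+_])
open import Data.List.Base as List using (List; length; lookup; filterᵇ; cartesianProduct; allFin)
open import Data.Nat.Base as ℕ using (ℕ; zero; suc)
open import Data.Product.Base using (_×_; _,_; proj₁; proj₂)
open import Data.Sum.Base as Sum using (_⊎_; inj₁; inj₂)
open import Data.Unit.Polymorphic.Base using (⊤)
import Data.Vec.Base as Vec
open import Data.Vec.Functional using (tail)
open import Function.Base using (_∘_)
open import Level using (Level; _⊔_) renaming (suc to lsuc)
open import Relation.Binary.Construct.Closure.ReflexiveTransitive using (Star)
open import Relation.Binary.Core using (Rel)
open import Relation.Binary.PropositionalEquality
  using (_≡_; refl; sym; trans; cong; cong₂)
open import Relation.Binary.Structures using (IsStrictPartialOrder)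
open import Relation.Nullary.Decidable using (does; yes; no; dec-true)
open import Relation.Nullary.Negation.Core using (¬_; contradiction)

------------------------------------------------------------------------
-- Scalars

-- The order is only required to be cotransitive and tight (through the
-- apartness of the Heyting field), not decidable, so that constructive as
-- well as classical real numbers are models.

record OrderedField c ℓ₁ ℓ₂ ℓ₃ : Set (lsuc (c ⊔ ℓ₁ ⊔ ℓ₂ ⊔ ℓ₃)) where
  infix 4 _<_ _≤_
  field
    heytingField : HeytingField c ℓ₁ ℓ₂

  open HeytingField heytingField public

  field
    _<_                  : Rel Carrier ℓ₃
    isStrictPartialOrder : IsStrictPartialOrder _≈_ _<_
    <⇒#                  : ∀ {x y} → x < y → x # y
    #⇒<⊎>                : ∀ {x y} → x # y → x < y ⊎ y < x
    0<1                  : 0# < 1#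
    +-monoˡ-<            : ∀ z {x y} → x < y → x + z < y + z
    *-pos                : ∀ {x y} → 0# < x → 0# < y → 0# < x * y

  _≤_ : Rel Carrier ℓ₃
  x ≤ y = ¬ (y < x)

  commutativeRing : CommutativeRing c ℓ₁
  commutativeRing = HeytingCommutativeRing.commutativeRing heytingCommutativeRing

  inverse : ∀ y → y # 0# → Carrier
  inverse y y#0 = proj₁ (#⇒invertible y#0)

------------------------------------------------------------------------
-- Graphs

record Graph (V : Set) : Set where
  field
    adj        : V → V → Bool
    adj-sym    : ∀ u v → adj u v ≡ adj v u
    adj-irrefl : ∀ v → adj v v ≡ false

open Graph public

Connected : ∀ {V} → Graph V → Set
Connected {V} G = V × (∀ u v → Star (λ a b → T (adj G a b)) u v)

neighbours : ∀ {n} → Graph (Fin n) → Fin n → Subset n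
neighbours G v = Vec.tabulate (adj G v)

degree : ∀ {n} → Graph (Fin n) → Fin n → ℕ
degree G v = ∣ neighbours G v ∣

Regular : ∀ {n} → ℕ → Graph (Fin n) → Set
Regular r G = ∀ v → degree G v ≡ r

-- Each edge {u , v} is listed once, as the pair with u < v.

edges : ∀ {n} → Graph (Fin n) → List (Fin n × Fin n)
edges {n} G =
  filterᵇ (λ (u , v) → does (u <? v) ∧ adj G u v) (cartesianProduct (allFin n) (allFin n))

size : ∀ {n} → Graph (Fin n) → ℕ
size G = length (edges G)

_∈ₑ_ : ∀ {n} → Fin n → Fin n × Fin n → Bool
w ∈ₑ (u , v) = does (w ≟ u) ∨ does (w ≟ v)

does-≟-sym : ∀ {n} (i j : Fin n) → does (i ≟ j) ≡ does (j ≟ i)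
does-≟-sym i j with i ≟ j | j ≟ i
... | yes _ | yes _ = refl
... | no  _ | no  _ = refl
... | yes p | no ¬q = contradiction (sym p) ¬q
... | no ¬p | yes q = contradiction (sym q) ¬p

-- The vertex inj₂ e of the central graph subdivides the e-th edge.

central : ∀ {n} (G : Graph (Fin n)) → Graph (Fin n ⊎ Fin (size G))
central {n} G = record { adj = a ; adj-sym = a-sym ; adj-irrefl = a-irrefl }
  where
  a : Fin n ⊎ Fin (size G) → Fin n ⊎ Fin (size G) → Bool
  a (inj₁ u) (inj₁ v) = not (does (u ≟ v)) ∧ not (adj G u v)
  a (inj₁ u) (inj₂ e) = u ∈ₑ lookup (edges G) e
  a (inj₂ e) (inj₁ u) = u ∈ₑ lookup (edges G) e
  a (inj₂ _) (inj₂ _) = false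

  a-sym : ∀ x y → a x y ≡ a y x
  a-sym (inj₁ u) (inj₁ v) =
    cong₂ _∧_ (cong not (does-≟-sym u v)) (cong not (adj-sym G u v))
  a-sym (inj₁ _) (inj₂ _) = refl
  a-sym (inj₂ _) (inj₁ _) = refl
  a-sym (inj₂ _) (inj₂ _) = refl

  a-irrefl : ∀ x → a x x ≡ false
  a-irrefl (inj₁ u) = cong (λ b → not b ∧ not (adj G u u)) (dec-true (u ≟ u) refl)
  a-irrefl (inj₂ _) = refl

CoronaVertex : ∀ {n₁} → Graph (Fin n₁) → ℕ → Set
CoronaVertex {n₁} G₁ n₂ = (Fin n₁ ⊎ Fin (size G₁)) ⊎ (Fin (size G₁) × Fin n₂)

-- inj₂ (e , w) is the vertex w in the e-th copy of G₂.  It is joined to the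
-- two ends of the e-th edge of G₁, so its degree is 2 + degree G₂ w and the
-- copies of G₂ contribute the factors x − 2 − μⱼ to the Laplacian
-- characteristic polynomial.  In the literature these factors are misprinted
-- as x − 1 − μⱼ, which is already wrong for K₂ and K₁: their corona is the
-- 4-cycle, with polynomial x (x − 2)² (x − 4).

centralEdgeNbhdCorona : ∀ {n₁ n₂} (G₁ : Graph (Fin n₁)) → Graph (Fin n₂) →
                        Graph (CoronaVertex G₁ n₂)
centralEdgeNbhdCorona {n₁} {n₂} G₁ G₂ =
  record { adj = a ; adj-sym = a-sym ; adj-irrefl = a-irrefl }
  where
  C = central G₁

  a : CoronaVertex G₁ n₂ → CoronaVertex G₁ n₂ → Bool
  a (inj₁ x)       (inj₁ y)         = adj C x y
  a (inj₁ x)       (inj₂ (e , _))   = adj C x (inj₂ e)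
  a (inj₂ (e , _)) (inj₁ x)         = adj C x (inj₂ e)
  a (inj₂ (e , w)) (inj₂ (e′ , w′)) = does (e ≟ e′) ∧ adj G₂ w w′

  a-sym : ∀ p q → a p q ≡ a q p
  a-sym (inj₁ x)       (inj₁ y)         = adj-sym C x y
  a-sym (inj₁ _)       (inj₂ _)         = refl
  a-sym (inj₂ _)       (inj₁ _)         = refl
  a-sym (inj₂ (e , w)) (inj₂ (e′ , w′)) = cong₂ _∧_ (does-≟-sym e e′) (adj-sym G₂ w w′)

  a-irrefl : ∀ p → a p p ≡ false
  a-irrefl (inj₁ x)       = adj-irrefl C x
  a-irrefl (inj₂ (e , w)) =
    trans (cong (does (e ≟ e) ∧_) (adj-irrefl G₂ w)) (∧-zeroʳ (does (e ≟ e)))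

pullback : ∀ {V W : Set} → (W → V) → Graph V → Graph W
pullback f G = record
  { adj        = λ u v → adj G (f u) (f v)
  ; adj-sym    = λ u v → adj-sym G (f u) (f v)
  ; adj-irrefl = λ v → adj-irrefl G (f v)
  }

coronaVertex : ∀ {n₁} (G₁ : Graph (Fin n₁)) (n₂ : ℕ) →
               Fin ((n₁ ℕ.+ size G₁) ℕ.+ size G₁ ℕ.* n₂) → CoronaVertex G₁ n₂
coronaVertex {n₁} G₁ n₂ =
  Sum.map (splitAt n₁) (remQuot n₂) ∘ splitAt (n₁ ℕ.+ size G₁)

infixl 7 _⊡_

_⊡_ : ∀ {n₁ n₂} (G₁ : Graph (Fin n₁)) → Graph (Fin n₂) →
      Graph (Fin ((n₁ ℕ.+ size G₁) ℕ.+ size G₁ ℕ.* n₂))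
_⊡_ {n₂ = n₂} G₁ G₂ = pullback (coronaVertex G₁ n₂) (centralEdgeNbhdCorona G₁ G₂)

------------------------------------------------------------------------
-- Matrices of a graph

module Matrices {c ℓ} (R : CommutativeRing c ℓ) where

  open CommutativeRing R hiding (refl; sym; trans; zero)
  open RawSemiringDefs (Semiring.rawSemiring semiring) public
    using (sum; product; _^_) renaming (_×_ to _×ᴿ_)

  ι : ℕ → Carrier
  ι n = n ×ᴿ 1#

  Matrix : ℕ → Set c
  Matrix n = Fin n → Fin n → Carrier

  identity : ∀ {n} → Matrix n
  identity i j = if does (i ≟ j) then 1# else 0#

  -- Laplace expansion along the first row.

  det : ∀ {n} → Matrix n → Carrier
  det {zero}  M = 1#
  det {suc n} M =
    sum λ j → (- 1#) ^ toℕ j * M zero j * det (λ i k → M (suc i) (punchIn j k))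

  charPoly : ∀ {n} → Matrix n → Carrier → Carrier
  charPoly M x = det λ i j → x * identity i j - M i j

  adjacency : ∀ {n} → Graph (Fin n) → Matrix n
  adjacency G i j = if adj G i j then 1# else 0#

  laplacian : ∀ {n} → Graph (Fin n) → Matrix n
  laplacian G i j = ι (degree G i) * identity i j - adjacency G i j

  -- The eigenvalues of M, listed with multiplicity.

  IsSpectrum : ∀ {n} → Matrix n → (Fin n → Carrier) → Set (c ⊔ ℓ)
  IsSpectrum M ev = ∀ x → charPoly M x ≈ product (λ i → x - ev i)

  -- ∏ᵢ₌₂ⁿ f i, where the first index is zero : Fin n.

  productFrom2 : ∀ {n} → (Fin n → Carrier) → Carrier
  productFrom2 {zero}  f = 1#
  productFrom2 {suc n} f = product (tail f)

------------------------------------------------------------------------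
-- Spectra and integer powers over an ordered field

module Spectral {c ℓ₁ ℓ₂ ℓ₃} ⦃ K : OrderedField c ℓ₁ ℓ₂ ℓ₃ ⦄ where

  open OrderedField K public
    using (Carrier; _≈_; _+_; _*_; _-_; 0#; 1#)
  open OrderedField K using (_#_; _≤_; inverse; commutativeRing)
  open Matrices commutativeRing public

  AdjacencyEigenvalues : ∀ {n} → Graph (Fin n) → (Fin n → Carrier) → Set _
  AdjacencyEigenvalues G ev =
    IsSpectrum (adjacency G) ev × (∀ i j → i Fin.≤ j → ev j ≤ ev i)

  LaplacianEigenvalues : ∀ {n} → Graph (Fin n) → (Fin n → Carrier) → Set _
  LaplacianEigenvalues G ev =
    IsSpectrum (laplacian G) ev × (∀ i j → i Fin.≤ j → ev i ≤ ev j)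

  -- The exponent m₁ − n₁ of x − 2 equals −1 when G₁ is K₁ or K₂; only then must
  -- x − 2 be invertible.

  PowerDefined : Carrier → ℤ → Set ℓ₂
  PowerDefined y (+ n)    = ⊤
  PowerDefined y -[1+ n ] = y # 0#

  power : ∀ y e → PowerDefined y e → Carrier
  power y (+ n)    _   = y ^ n
  power y -[1+ n ] y#0 = inverse y y#0 ^ suc n

module Submission where

-- Put y = x − 2 and P = y I − L(G₂), let A and B be the adjacency matrix and
-- the vertex-edge incidence matrix of G₁, and J an all-ones matrix.  With the
-- vertices of the corona ordered as vertices of G₁, subdivision vertices and
-- vertices of the copies of G₂, the matrix x I − L of the corona is
--
--   (  C        B      B ⊗ 1ᵀ )
--   (  Bᵀ       y I    0      )
--   (  Bᵀ ⊗ 1   0      I ⊗ P  ).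
--
-- The columns of L(G₂) sum to zero, so 1ᵀ P = y 1ᵀ.  Hence, once the first
-- block row is multiplied by y, subtracting combinations of the lower rows
-- clears both upper right blocks without a division (det-eliminate).  As
-- B Bᵀ = r I + A (incidence-gram), the result is
--
--   yⁿ det (x I − L) = det (a I + y J − c A) · yᵐ · det(P)ᵐ
--
-- with a = y (x − n − n₂ r) − (n₂ + 1) r and c = y + n₂ + 1, where G₁ has n
-- vertices and m edges (corona-determinant).
--
-- All columns of a I − c A have the sum t = a − c r, and therefore
-- det (a I − c A + b J) = (t + n b) D with D independent of b
-- (det-constant-column-sums).  For b = 0 this reads
-- t D = det (a I − c A) = ∏ᵢ (a − c λᵢ).  The first factor of the product is
-- t, because λ₁ = r.  Both sides are polynomial in a, so t may be cancelled,
-- and D = ∏ᵢ₌₂ⁿ (a − c λᵢ) (reduced-spectrum).  The choice b = y gives the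
-- quadratic factors of the theorem.
--
-- That λ₁ = r (largest-eigenvalue) is a matter of order: det (x I − A) vanishes
-- at x = r, but for x > r the matrix x I − A is a diagonally dominant M-matrix,
-- whose determinant is positive (det-M-matrix-pos).
--
-- It remains to cancel yⁿ.  When the exponent m − n is negative, y is
-- invertible by assumption.  Otherwise both sides are polynomial functions of x
-- and the factor can be cancelled even at x = 2 (cancel-linear-^): a polynomial
-- function that vanishes at t + 1, t + 2, … vanishes at t
-- (polynomial-determined), and if t − a is zero then t + 1 − a, t + 2 − a, …
-- are invertible.  Deciding whether t − a is zero is avoided by tightness of the
-- apartness (≈-by-cases).

open import Defs
open import Algebra.Bundles using (CommutativeRing; Monoid)
import Algebra.Apartness.Properties.HeytingCommutativeRing
import Algebra.Properties.AbelianGroup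
import Algebra.Properties.CommutativeSemiring.Exp
import Algebra.Properties.Ring
import Algebra.Properties.Semiring.Exp
import Algebra.Properties.Semiring.Mult
import Algebra.Properties.Semiring.Sum
import Algebra.Solver.Ring
open import Algebra.Solver.Ring.AlmostCommutativeRing using (fromCommutativeRing; _-Raw-AlmostCommutative⟶_)
open import Data.Bool.Base using (Bool; true; false; not; _∧_; if_then_else_)
open import Data.Bool.Properties using (T?; T-∧)
open import Data.Empty using (⊥; ⊥-elim)
open import Data.Fin.Base as Fin
  using (Fin; zero; suc; _↑ˡ_; _↑ʳ_; inject₁; punchIn; toℕ; splitAt; combine; remQuot; quotient)
open import Data.Fin.Properties as Fin
  using ( _≟_; _<?_; <⇒≢; <-cmp; splitAt-↑ˡ; splitAt-↑ʳ; combine-remQuot; remQuot-combine; combine-injective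
        ; ↑ˡ-injective; ↑ʳ-injective)
open import Data.Fin.Subset using (∣_∣)
open import Data.Integer.Base as ℤ using (ℤ; +_; -[1+_]; _⊖_)
import Data.Integer.Properties as ℤ
open import Data.List.Base as List using (List; lookup; filterᵇ; cartesianProduct; allFin)
open import Data.List.Membership.Propositional.Properties using (∈-lookup; ∈-filter⁻)
open import Data.Maybe.Base using (Maybe; just; nothing)
open import Data.Nat.Base as ℕ using (ℕ; zero; suc; z≤n; s≤s)
import Data.Nat.Properties as ℕ
open import Data.Product.Base using (_×_; _,_; proj₁; proj₂; ∃-syntax)
open import Data.Sum.Base as Sum using (_⊎_; inj₁; inj₂; [_,_]′)
import Data.Vec.Base as Vec
open import Data.Vec.Functional using (_∷_; tail)
open import Function.Base using (_∘_; id)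
open import Function.Bundles using (Equivalence)
open import Level using (_⊔_)
open import Relation.Binary.Definitions using (tri<; tri≈; tri>)
open import Relation.Binary.PropositionalEquality as ≡ using (_≡_; _≢_)
import Relation.Binary.Reasoning.Setoid
open import Relation.Binary.Structures using (IsStrictPartialOrder)
open import Relation.Nullary.Decidable using (yes; no; does; dec-true; dec-false)
open import Relation.Nullary.Negation.Core using (¬_; contradiction)

-- Sums over a disjoint union of index sets

module MonoidSums {c ℓ} (M : Monoid c ℓ) where
  open Monoid M
  open import Algebra.Definitions.RawMonoid rawMonoid using (sum)

  sum-↑ : ∀ k {l} (f : Fin (k ℕ.+ l) → Carrier) →
          sum f ≈ sum (λ i → f (i ↑ˡ l)) ∙ sum (λ i → f (k ↑ʳ i))
  sum-↑ zero    f = sym (identityˡ _)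
  sum-↑ (suc k) f = trans (∙-congˡ (sum-↑ k (f ∘ suc))) (sym (assoc _ _ _))

-- A ring solver with integer coefficients.  Equality of coefficients has to be
-- decided, so the elements of R itself cannot serve as coefficients.

module IntegerSolver {c ℓ} (R : CommutativeRing c ℓ) where
  open CommutativeRing R hiding (zero)
  open Matrices R using (ι)
  open Algebra.Properties.Semiring.Mult semiring using (×-homo-+; ×1-homo-*)
  open Algebra.Properties.Ring ring using (-‿distribˡ-*; -‿distribʳ-*; -0#≈0#; -‿involutive)
  open Algebra.Properties.AbelianGroup +-abelianGroup using (⁻¹-∙-comm)
  open Relation.Binary.Reasoning.Setoid setoid

  private
    -- the ring homomorphism from the integers
    canonical : ℤ → Carrier
    canonical (+ n)    = ι n
    canonical -[1+ n ] = - ι (suc n)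

    canonical-⊖ : ∀ m n → canonical (m ⊖ n) ≈ ι m - ι n
    canonical-⊖ zero    zero    = sym (-‿inverseʳ 0#)
    canonical-⊖ zero    (suc n) = sym (+-identityˡ _)
    canonical-⊖ (suc m) zero    = sym (trans (+-congˡ -0#≈0#) (+-identityʳ _))
    canonical-⊖ (suc m) (suc n) = begin
      canonical (suc m ⊖ suc n)         ≡⟨ ≡.cong canonical (ℤ.[1+m]⊖[1+n]≡m⊖n m n) ⟩
      canonical (m ⊖ n)                 ≈⟨ canonical-⊖ m n ⟩
      ι m - ι n                         ≈⟨ +-congˡ (+-identityˡ _) ⟨
      ι m + (0# - ι n)                  ≈⟨ +-congˡ (+-congʳ (-‿inverseʳ 1#)) ⟨
      ι m + (1# - 1# - ι n)             ≈⟨ +-congˡ (+-assoc _ _ _) ⟩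
      ι m + (1# + (- 1# - ι n))         ≈⟨ +-assoc _ _ _ ⟨
      (ι m + 1#) + (- 1# - ι n)         ≈⟨ +-cong (+-comm _ _) (⁻¹-∙-comm _ _) ⟩
      ι (suc m) - ι (suc n)             ∎

    canonical-+ : ∀ i j → canonical (i ℤ.+ j) ≈ canonical i + canonical j
    canonical-+ (+ m)    (+ n)    = ×-homo-+ 1# m n
    canonical-+ (+ m)    -[1+ n ] = canonical-⊖ m (suc n)
    canonical-+ -[1+ m ] (+ n)    = trans (canonical-⊖ n (suc m)) (+-comm _ _)
    canonical-+ -[1+ m ] -[1+ n ] = begin
      - ι (suc (suc (m ℕ.+ n)))   ≡⟨ ≡.cong (λ k → - ι k) (≡.sym (ℕ.+-suc (suc m) n)) ⟩
      - ι (suc m ℕ.+ suc n)       ≈⟨ -‿cong (×-homo-+ 1# (suc m) (suc n)) ⟩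
      - (ι (suc m) + ι (suc n))   ≈⟨ ⁻¹-∙-comm _ _ ⟨
      - ι (suc m) - ι (suc n)     ∎

    canonical-neg : ∀ i → canonical (ℤ.- i) ≈ - canonical i
    canonical-neg (+ zero)  = sym -0#≈0#
    canonical-neg (+ suc n) = refl
    canonical-neg -[1+ n ]  = sym (-‿involutive _)

    canonical-+* : ∀ m j → canonical (+ m ℤ.* j) ≈ ι m * canonical j
    canonical-+* m (+ n) = begin
      canonical (+ m ℤ.* + n)   ≡⟨ ≡.cong canonical (≡.sym (ℤ.pos-* m n)) ⟩
      ι (m ℕ.* n)               ≈⟨ ×1-homo-* m n ⟩
      ι m * ι n                 ∎
    canonical-+* m -[1+ n ] = begin
      canonical (+ m ℤ.* -[1+ n ])         ≡⟨ ≡.cong canonical (≡.sym (ℤ.neg-distribʳ-* (+ m) (+ suc n))) ⟩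
      canonical (ℤ.- (+ m ℤ.* + suc n))    ≈⟨ canonical-neg (+ m ℤ.* + suc n) ⟩
      - canonical (+ m ℤ.* + suc n)        ≈⟨ -‿cong (canonical-+* m (+ suc n)) ⟩
      - (ι m * ι (suc n))                  ≈⟨ -‿distribʳ-* _ _ ⟩
      ι m * - ι (suc n)                    ∎

    canonical-* : ∀ i j → canonical (i ℤ.* j) ≈ canonical i * canonical j
    canonical-* (+ m)    j = canonical-+* m j
    canonical-* -[1+ m ] j = begin
      canonical (-[1+ m ] ℤ.* j)           ≡⟨ ≡.cong canonical (≡.sym (ℤ.neg-distribˡ-* (+ suc m) j)) ⟩
      canonical (ℤ.- (+ suc m ℤ.* j))      ≈⟨ canonical-neg (+ suc m ℤ.* j) ⟩
      - canonical (+ suc m ℤ.* j)          ≈⟨ -‿cong (canonical-+* (suc m) j) ⟩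
      - (ι (suc m) * canonical j)          ≈⟨ -‿distribˡ-* _ _ ⟩
      - ι (suc m) * canonical j            ∎

    -- 1 is sent to 1# itself, so that the constants 0#, 1# and ι n of a goal
    -- are all of the form ⟦ i ⟧.
    ⟦_⟧ : ℤ → Carrier
    ⟦ + 1 ⟧ = 1#
    ⟦ i   ⟧ = canonical i

    ⟦⟧≈canonical : ∀ i → ⟦ i ⟧ ≈ canonical i
    ⟦⟧≈canonical (+ 0)           = refl
    ⟦⟧≈canonical (+ 1)           = sym (+-identityʳ 1#)
    ⟦⟧≈canonical (+ suc (suc n)) = refl
    ⟦⟧≈canonical -[1+ n ]        = refl

    morphism : ℤ.+-*-rawRing -Raw-AlmostCommutative⟶ fromCommutativeRing R
    morphism = record
      { ⟦_⟧    = ⟦_⟧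
      ; +-homo = λ i j → trans (⟦⟧≈canonical (i ℤ.+ j))
          (trans (canonical-+ i j) (sym (+-cong (⟦⟧≈canonical i) (⟦⟧≈canonical j))))
      ; *-homo = λ i j → trans (⟦⟧≈canonical (i ℤ.* j))
          (trans (canonical-* i j) (sym (*-cong (⟦⟧≈canonical i) (⟦⟧≈canonical j))))
      ; -‿homo = λ i → trans (⟦⟧≈canonical (ℤ.- i))
          (trans (canonical-neg i) (sym (-‿cong (⟦⟧≈canonical i))))
      ; 0-homo = refl
      ; 1-homo = refl
      }

    equal? : ∀ i j → Maybe (⟦ i ⟧ ≈ ⟦ j ⟧)
    equal? i j with i ℤ.≟ j
    ... | yes ≡.refl = just refl
    ... | no  _      = nothing

  open Algebra.Solver.Ring ℤ.+-*-rawRing (fromCommutativeRing R) morphism equal? public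
    using (solve; _:=_; _:+_; _:*_; _:-_; :-_; con; Polynomial)

  :1 : ∀ {n} → Polynomial n
  :1 = con (+ 1)

  :0 : ∀ {n} → Polynomial n
  :0 = con (+ 0)

-- Determinants

-- Deleting column p and then column q of the rest (p ≤ q) is the same as
-- deleting column suc q and then column p of the rest.

punchIn-comm : ∀ {n} (p q : Fin (suc n)) → p Fin.≤ q → ∀ l →
               punchIn (inject₁ p) (punchIn q l) ≡ punchIn (suc q) (punchIn p l)
punchIn-comm zero    q       _         l       = ≡.refl
punchIn-comm (suc p) (suc q) (s≤s p≤q) zero    = ≡.refl
punchIn-comm (suc p) (suc q) (s≤s p≤q) (suc l) = ≡.cong suc (punchIn-comm p q p≤q l)

punchIn-inject₁ : ∀ {n} (p q : Fin n) → p Fin.≤ q → punchIn (inject₁ p) q ≡ suc q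
punchIn-inject₁ zero    q       _         = ≡.refl
punchIn-inject₁ (suc p) (suc q) (s≤s p≤q) = ≡.cong suc (punchIn-inject₁ p q p≤q)

punchIn-suc : ∀ {n} (p q : Fin n) → p Fin.≤ q → punchIn (suc q) p ≡ inject₁ p
punchIn-suc zero    q       _         = ≡.refl
punchIn-suc (suc p) (suc q) (s≤s p≤q) = ≡.cong suc (punchIn-suc p q p≤q)

punchIn-↑ˡ : ∀ {k} l (i : Fin (suc k)) (j : Fin k) → punchIn (i ↑ˡ l) (j ↑ˡ l) ≡ punchIn i j ↑ˡ l
punchIn-↑ˡ l zero    j       = ≡.refl
punchIn-↑ˡ l (suc i) zero    = ≡.refl
punchIn-↑ˡ l (suc i) (suc j) = ≡.cong suc (punchIn-↑ˡ l i j)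

punchIn-↑ʳ : ∀ k {l} (i : Fin (suc k)) (j : Fin l) → punchIn (i ↑ˡ l) (k ↑ʳ j) ≡ suc k ↑ʳ j
punchIn-↑ʳ k       zero    j = ≡.refl
punchIn-↑ʳ (suc k) (suc i) j = ≡.cong suc (punchIn-↑ʳ k i j)

module Determinant {c ℓ} (R : CommutativeRing c ℓ) where
  open CommutativeRing R hiding (zero)
  open Matrices R
  open IntegerSolver R
  open Algebra.Properties.Semiring.Sum semiring
    using (sum-cong-≋; ∑-distrib-+; *-distribˡ-sum; *-distribʳ-sum; sum-replicate)
  open Algebra.Properties.Ring ring using (-‿distribˡ-*)
  open MonoidSums *-monoid public using () renaming (sum-↑ to product-↑)
  open Relation.Binary.Reasoning.Setoid setoid

  -- the sign of column j in the Laplace expansion along the first row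

  sign : ∀ {n} → Fin n → Carrier
  sign j = (- 1#) ^ toℕ j

  deleteColumn : ∀ {m n} → (Fin m → Fin (suc n) → Carrier) → Fin (suc n) → Fin m → Fin n → Carrier
  deleteColumn M j i k = M i (punchIn j k)

  -- ∑ and Det are the given sum and det.  They are opaque because sum and det
  -- compute by matching on the size, which would keep unification from reading
  -- off the summand or the matrix.

  opaque
    ∑ : ∀ {n} → (Fin n → Carrier) → Carrier
    ∑ = sum

    ∑-[] : (f : Fin 0 → Carrier) → ∑ f ≡ 0#
    ∑-[] f = ≡.refl

    ∑-suc : ∀ {n} (f : Fin (suc n) → Carrier) → ∑ f ≡ f zero + ∑ (f ∘ suc)
    ∑-suc f = ≡.refl

    ∑-cong : ∀ {n} {f g : Fin n → Carrier} → (∀ i → f i ≈ g i) → ∑ f ≈ ∑ g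
    ∑-cong = sum-cong-≋

    ∑-+ : ∀ {n} (f g : Fin n → Carrier) → ∑ (λ i → f i + g i) ≈ ∑ f + ∑ g
    ∑-+ = ∑-distrib-+

    ∑-*ˡ : ∀ {n} x (f : Fin n → Carrier) → ∑ (λ i → x * f i) ≈ x * ∑ f
    ∑-*ˡ x f = sym (*-distribˡ-sum x f)

    ∑-*ʳ : ∀ {n} (f : Fin n → Carrier) x → ∑ (λ i → f i * x) ≈ ∑ f * x
    ∑-*ʳ f x = sym (*-distribʳ-sum x f)

    ∑-1 : ∀ n → ∑ {n} (λ _ → 1#) ≈ ι n
    ∑-1 n = sum-replicate n

    ∑-↑ : ∀ k {l} (f : Fin (k ℕ.+ l) → Carrier) →
          ∑ f ≈ ∑ (λ i → f (i ↑ˡ l)) + ∑ (λ i → f (k ↑ʳ i))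
    ∑-↑ = MonoidSums.sum-↑ +-monoid

    Det : ∀ {n} → Matrix n → Carrier
    Det = det

    Det≡det : ∀ {n} (M : Matrix n) → Det M ≡ det M
    Det≡det M = ≡.refl

    Det-[] : (M : Matrix 0) → Det M ≡ 1#
    Det-[] M = ≡.refl

    Det-expand : ∀ {n} (M : Matrix (suc n)) →
                 Det M ≡ ∑ (λ j → sign j * M zero j * Det (deleteColumn (tail M) j))
    Det-expand M = ≡.refl

  ∑-zero : ∀ {n} {f : Fin n → Carrier} → (∀ i → f i ≈ 0#) → ∑ f ≈ 0#
  ∑-zero {n} {f} f≈0 = begin
    ∑ f                ≈⟨ ∑-cong (λ i → trans (f≈0 i) (sym (zeroˡ 0#))) ⟩
    ∑ (λ _ → 0# * 0#)  ≈⟨ ∑-*ˡ 0# _ ⟩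
    0# * ∑ (λ _ → 0#)  ≈⟨ zeroˡ _ ⟩
    0#                 ∎

  ∑-const : ∀ n x → ∑ {n} (λ _ → x) ≈ ι n * x
  ∑-const n x = begin
    ∑ {n} (λ _ → x)         ≈⟨ ∑-cong (λ _ → sym (*-identityˡ x)) ⟩
    ∑ {n} (λ _ → 1# * x)    ≈⟨ ∑-*ʳ _ x ⟩
    ∑ {n} (λ _ → 1#) * x    ≈⟨ *-congʳ (∑-1 n) ⟩
    ι n * x                 ∎

  ∑-combine : ∀ m {k} (f : Fin (m ℕ.* k) → Carrier) → ∑ f ≈ ∑ (λ e → ∑ (λ w → f (combine {m} e w)))
  ∑-combine zero    f = reflexive (≡.trans (∑-[] _) (≡.sym (∑-[] _)))
  ∑-combine (suc m) {k} f = begin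
    ∑ f                                                               ≈⟨ ∑-↑ k f ⟩
    ∑ (λ w → f (w ↑ˡ m ℕ.* k)) + ∑ (λ i → f (k ↑ʳ i))                 ≈⟨ +-congˡ (∑-combine m (λ i → f (k ↑ʳ i))) ⟩
    ∑ (λ w → f (w ↑ˡ m ℕ.* k)) + ∑ (λ e → ∑ (λ w → f (k ↑ʳ combine {m} e w)))  ≡⟨ ∑-suc _ ⟨
    ∑ (λ e → ∑ (λ w → f (combine {suc m} e w)))                       ∎

  ∑-neg : ∀ {n} (f : Fin n → Carrier) → ∑ (λ i → - f i) ≈ - ∑ f
  ∑-neg f = begin
    ∑ (λ i → - f i)        ≈⟨ ∑-cong (λ i → solve 1 (λ x → :- x := :- :1 :* x) refl (f i)) ⟩
    ∑ (λ i → - 1# * f i)   ≈⟨ ∑-*ˡ (- 1#) f ⟩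
    - 1# * ∑ f             ≈⟨ solve 1 (λ x → :- :1 :* x := :- x) refl (∑ f) ⟩
    - ∑ f                  ∎

  product-cong : ∀ {n} {f g : Fin n → Carrier} → (∀ i → f i ≈ g i) → product f ≈ product g
  product-cong {zero}  f≈g = refl
  product-cong {suc n} f≈g = *-cong (f≈g zero) (product-cong (f≈g ∘ suc))

  product-replicate : ∀ n x → product {n} (λ _ → x) ≈ x ^ n
  product-replicate zero    x = refl
  product-replicate (suc n) x = *-congˡ (product-replicate n x)

  product-one : ∀ {n} {f : Fin n → Carrier} → (∀ i → f i ≈ 1#) → product f ≈ 1#
  product-one {zero}  f≈1 = refl
  product-one {suc n} f≈1 = trans (*-cong (f≈1 zero) (product-one (f≈1 ∘ suc))) (*-identityˡ 1#)

  product-* : ∀ {n} (f g : Fin n → Carrier) → product (λ i → f i * g i) ≈ product f * product g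
  product-* {zero}  f g = sym (*-identityˡ 1#)
  product-* {suc n} f g = trans (*-congˡ (product-* (f ∘ suc) (g ∘ suc)))
    (solve 4 (λ a b p q → a :* b :* (p :* q) := a :* p :* (b :* q)) refl _ _ _ _)

  ^-cong : ∀ {x y} n → x ≈ y → x ^ n ≈ y ^ n
  ^-cong zero    x≈y = refl
  ^-cong (suc n) x≈y = *-cong x≈y (^-cong n x≈y)

  -- The identity matrix

  identity-≢ : ∀ {n} {i j : Fin n} → i ≢ j → identity i j ≡ 0#
  identity-≢ {i = i} {j} i≢j = ≡.cong (if_then 1# else 0#) (dec-false (i ≟ j) i≢j)

  identity-≡ : ∀ {n} (i : Fin n) → identity i i ≡ 1#
  identity-≡ i = ≡.cong (if_then 1# else 0#) (dec-true (i ≟ i) ≡.refl)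

  identity-injective : ∀ {m n} {f : Fin m → Fin n} → (∀ {i j} → f i ≡ f j → i ≡ j) →
                       ∀ i j → identity (f i) (f j) ≡ identity i j
  identity-injective {f = f} inj i j with i ≟ j
  ... | yes ≡.refl = identity-≡ (f i)
  ... | no  i≢j    = identity-≢ (i≢j ∘ inj)

  identity-sym : ∀ {n} (i j : Fin n) → identity i j ≡ identity j i
  identity-sym i j = ≡.cong (if_then 1# else 0#) (does-≟-sym i j)

  ∑-identity : ∀ {n} (i : Fin n) (f : Fin n → Carrier) → ∑ (λ j → identity i j * f j) ≈ f i
  ∑-identity zero f = begin
    ∑ (λ j → identity zero j * f j)          ≡⟨ ∑-suc _ ⟩
    1# * f zero + ∑ (λ j → 0# * f (suc j)) ≈⟨ +-cong (*-identityˡ _) (∑-zero (λ j → zeroˡ _)) ⟩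
    f zero + 0#                              ≈⟨ +-identityʳ _ ⟩
    f zero                                   ∎
  ∑-identity (suc i) f = begin
    ∑ (λ j → identity (suc i) j * f j)
      ≡⟨ ∑-suc _ ⟩
    0# * f zero + ∑ (λ j → identity (suc i) (suc j) * f (suc j))
      ≈⟨ +-cong (zeroˡ _) (∑-cong (λ j → *-congʳ (reflexive (identity-injective Fin.suc-injective i j)))) ⟩
    0# + ∑ (λ j → identity i j * f (suc j))
      ≈⟨ +-identityˡ _ ⟩
    ∑ (λ j → identity i j * f (suc j))
      ≈⟨ ∑-identity i (f ∘ suc) ⟩
    f (suc i) ∎

  -- Linearity in the first row

  det-cong : ∀ {n} {M N : Matrix n} → (∀ i j → M i j ≈ N i j) → Det M ≈ Det N
  det-cong {zero}  {M} {N} M≈N = reflexive (≡.trans (Det-[] M) (≡.sym (Det-[] N)))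
  det-cong {suc n} {M} {N} M≈N = begin
    Det M
      ≡⟨ Det-expand M ⟩
    ∑ (λ j → sign j * M zero j * Det (deleteColumn (tail M) j))
      ≈⟨ ∑-cong (λ j → *-cong (*-congˡ (M≈N zero j)) (det-cong λ i k → M≈N (suc i) (punchIn j k))) ⟩
    ∑ (λ j → sign j * N zero j * Det (deleteColumn (tail N) j))
      ≡⟨ Det-expand N ⟨
    Det N ∎

  det-first-row-+ : ∀ {n} (a b : Fin (suc n) → Carrier) M →
                    Det ((λ j → a j + b j) ∷ M) ≈ Det (a ∷ M) + Det (b ∷ M)
  det-first-row-+ a b M = begin
    Det ((λ j → a j + b j) ∷ M)
      ≡⟨ Det-expand _ ⟩
    ∑ (λ j → sign j * (a j + b j) * d j)
      ≈⟨ ∑-cong (λ j → solve 4 (λ s a b d → s :* (a :+ b) :* d := s :* a :* d :+ s :* b :* d)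
                           refl (sign j) (a j) (b j) (d j)) ⟩
    ∑ (λ j → sign j * a j * d j + sign j * b j * d j)
      ≈⟨ ∑-+ _ _ ⟩
    ∑ (λ j → sign j * a j * d j) + ∑ (λ j → sign j * b j * d j)
      ≡⟨ ≡.cong₂ _+_ (Det-expand (a ∷ M)) (Det-expand (b ∷ M)) ⟨
    Det (a ∷ M) + Det (b ∷ M) ∎
    where
    d : ∀ j → Carrier
    d j = Det (deleteColumn M j)

  det-first-row-* : ∀ {n} x (a : Fin (suc n) → Carrier) M →
                    Det ((λ j → x * a j) ∷ M) ≈ x * Det (a ∷ M)
  det-first-row-* x a M = begin
    Det ((λ j → x * a j) ∷ M)
      ≡⟨ Det-expand _ ⟩
    ∑ (λ j → sign j * (x * a j) * d j)
      ≈⟨ ∑-cong (λ j → solve 4 (λ s x a d → s :* (x :* a) :* d := x :* (s :* a :* d))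
                           refl (sign j) x (a j) (d j)) ⟩
    ∑ (λ j → x * (sign j * a j * d j))
      ≈⟨ ∑-*ˡ x _ ⟩
    x * ∑ (λ j → sign j * a j * d j)
      ≡⟨ ≡.cong (x *_) (Det-expand (a ∷ M)) ⟨
    x * Det (a ∷ M) ∎
    where
    d : ∀ j → Carrier
    d j = Det (deleteColumn M j)

  det-first-row-zero : ∀ {n} {a : Fin (suc n) → Carrier} M → (∀ j → a j ≈ 0#) → Det (a ∷ M) ≈ 0#
  det-first-row-zero {a = a} M a≈0 = trans (reflexive (Det-expand (a ∷ M))) (∑-zero λ j →
    trans (*-congʳ (trans (*-congˡ (a≈0 j)) (zeroʳ _))) (zeroˡ _))

  det-first-row-∑ : ∀ {m n} (x : Fin m → Carrier) (a : Fin m → Fin (suc n) → Carrier) M →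
                    Det ((λ j → ∑ (λ k → x k * a k j)) ∷ M) ≈ ∑ (λ k → x k * Det (a k ∷ M))
  det-first-row-∑ {zero}  x a M = trans (det-first-row-zero M (λ j → reflexive (∑-[] _))) (reflexive (≡.sym (∑-[] _)))
  det-first-row-∑ {suc m} x a M = begin
    Det ((λ j → ∑ (λ k → x k * a k j)) ∷ M)
      ≈⟨ det-cong (λ { zero j → reflexive (∑-suc _) ; (suc i) j → refl }) ⟩
    Det ((λ j → x zero * a zero j + ∑ (λ k → x (suc k) * a (suc k) j)) ∷ M)
      ≈⟨ det-first-row-+ (λ j → x zero * a zero j) (λ j → ∑ (λ k → x (suc k) * a (suc k) j)) M ⟩
    Det ((λ j → x zero * a zero j) ∷ M) + Det ((λ j → ∑ (λ k → x (suc k) * a (suc k) j)) ∷ M)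
      ≈⟨ +-cong (det-first-row-* (x zero) (a zero) M) (det-first-row-∑ (x ∘ suc) (a ∘ suc) M) ⟩
    x zero * Det (a zero ∷ M) + ∑ (λ k → x (suc k) * Det (a (suc k) ∷ M))
      ≡⟨ ∑-suc _ ⟨
    ∑ (λ k → x k * Det (a k ∷ M)) ∎

  det-rows-* : ∀ {n} (d : Fin n → Carrier) M → Det (λ i j → d i * M i j) ≈ product d * Det M
  det-rows-* {zero}  d M = trans (reflexive (≡.trans (Det-[] _) (≡.sym (Det-[] M)))) (sym (*-identityˡ _))
  det-rows-* {suc n} d M = begin
    Det (λ i j → d i * M i j)
      ≡⟨ Det-expand _ ⟩
    ∑ (λ j → sign j * (d zero * M zero j) * Det (λ i k → d (suc i) * M (suc i) (punchIn j k)))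
      ≈⟨ ∑-cong (λ j → *-congˡ (det-rows-* (d ∘ suc) (deleteColumn (M ∘ suc) j))) ⟩
    ∑ (λ j → sign j * (d zero * M zero j) * (product (d ∘ suc) * Det (deleteColumn (M ∘ suc) j)))
      ≈⟨ ∑-cong (λ j → solve 5 (λ s d m p r → s :* (d :* m) :* (p :* r) := d :* p :* (s :* m :* r))
                           refl (sign j) (d zero) (M zero j) (product (d ∘ suc)) (Det (deleteColumn (M ∘ suc) j))) ⟩
    ∑ (λ j → product d * (sign j * M zero j * Det (deleteColumn (M ∘ suc) j)))
      ≈⟨ ∑-*ˡ (product d) _ ⟩
    product d * ∑ (λ j → sign j * M zero j * Det (deleteColumn (M ∘ suc) j))
      ≡⟨ ≡.cong (product d *_) (Det-expand M) ⟨
    product d * Det M ∎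

  -- Alternation

  -- A double Laplace expansion is a sum over j, the first deleted column, and k,
  -- the second one among the remaining columns.  The pairs (p , q) and
  -- (suc q , p) with p ≤ q delete the same two columns and have opposite signs.

  alternating-sum : ∀ n (F : Fin (suc n) → Fin n → Carrier) →
                    (∀ p q → p Fin.≤ q → F (inject₁ p) q ≈ F (suc q) p) →
                    ∑ (λ j → ∑ (λ k → sign j * sign k * F j k)) ≈ 0#
  alternating-sum zero    F F-sym = ∑-zero (λ _ → reflexive (∑-[] _))
  alternating-sum (suc n) F F-sym = begin
    ∑ (λ j → ∑ (λ k → sign j * sign k * F j k))
      ≡⟨ ∑-suc _ ⟩
    ∑ (λ k → sign 0F * sign k * F zero k) +
      ∑ (λ j → ∑ (λ k → sign (suc j) * sign k * F (suc j) k))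
      ≈⟨ +-congˡ (∑-cong λ j → reflexive (∑-suc _)) ⟩
    ∑ (λ k → sign 0F * sign k * F zero k) +
      ∑ (λ j → sign (suc j) * sign 0F * F (suc j) zero + ∑ (λ k → sign (suc j) * sign (suc k) * F (suc j) (suc k)))
      ≈⟨ +-congˡ (∑-+ _ _) ⟩
    ∑ (λ k → sign 0F * sign k * F zero k) +
      (∑ (λ j → sign (suc j) * sign 0F * F (suc j) zero) +
       ∑ (λ j → ∑ (λ k → sign (suc j) * sign (suc k) * F (suc j) (suc k))))
      ≈⟨ +-assoc _ _ _ ⟨
    ∑ (λ k → sign 0F * sign k * F zero k) +
      ∑ (λ j → sign (suc j) * sign 0F * F (suc j) zero) +
      ∑ (λ j → ∑ (λ k → sign (suc j) * sign (suc k) * F (suc j) (suc k)))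
      ≈⟨ +-cong edge core ⟩
    0# + 0#
      ≈⟨ +-identityˡ 0# ⟩
    0# ∎
    where
    0F : Fin (suc n)
    0F = zero
    -- the pairs that involve column 0; core collects the others
    edge : ∑ (λ k → sign 0F * sign k * F zero k) + ∑ (λ j → sign (suc j) * sign 0F * F (suc j) zero) ≈ 0#
    edge = trans (sym (∑-+ _ _)) (∑-zero λ j → begin
      1# * sign j * F zero j + - 1# * sign j * 1# * F (suc j) zero
        ≈⟨ +-congʳ (*-congˡ (F-sym zero j z≤n)) ⟩
      1# * sign j * F (suc j) zero + - 1# * sign j * 1# * F (suc j) zero
        ≈⟨ solve 2 (λ s f → :1 :* s :* f :+ :- :1 :* s :* :1 :* f := :0) refl (sign j) (F (suc j) zero) ⟩
      0# ∎)
    core : ∑ (λ j → ∑ (λ k → sign (suc j) * sign (suc k) * F (suc j) (suc k))) ≈ 0#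
    core = begin
      ∑ (λ j → ∑ (λ k → sign (suc j) * sign (suc k) * F (suc j) (suc k)))
        ≈⟨ ∑-cong (λ j → ∑-cong (λ k →
             solve 3 (λ s t f → :- :1 :* s :* (:- :1 :* t) :* f := s :* t :* f) refl (sign j) (sign k) (F (suc j) (suc k)))) ⟩
      ∑ (λ j → ∑ (λ k → sign j * sign k * F (suc j) (suc k)))
        ≈⟨ alternating-sum n (λ j k → F (suc j) (suc k)) (λ p q p≤q → F-sym (suc p) (suc q) (s≤s p≤q)) ⟩
      0# ∎

  module _ {n} (M : Fin n → Fin (suc (suc n)) → Carrier) where
    private
      -- the double expansion along two first rows a and b, without signs
      term : (a b : Fin (suc (suc n)) → Carrier) → Fin (suc (suc n)) → Fin (suc n) → Carrier
      term a b j k = a j * b (punchIn j k) * Det (deleteColumn (deleteColumn M j) k)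

      det-two-rows : ∀ a b → Det (a ∷ b ∷ M) ≈ ∑ (λ j → ∑ (λ k → sign j * sign k * term a b j k))
      det-two-rows a b = trans (reflexive (Det-expand (a ∷ b ∷ M))) (∑-cong λ j → begin
        sign j * a j * Det (deleteColumn (b ∷ M) j)
          ≡⟨ ≡.cong (sign j * a j *_) (Det-expand (deleteColumn (b ∷ M) j)) ⟩
        sign j * a j * ∑ (λ k → sign k * b (punchIn j k) * Det (deleteColumn (deleteColumn M j) k))
          ≈⟨ ∑-*ˡ _ _ ⟨
        ∑ (λ k → sign j * a j * (sign k * b (punchIn j k) * Det (deleteColumn (deleteColumn M j) k)))
          ≈⟨ ∑-cong (λ k → solve 5 (λ s a t b d → s :* a :* (t :* b :* d) := s :* t :* (a :* b :* d))
               refl (sign j) (a j) (sign k) (b (punchIn j k)) _) ⟩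
        ∑ (λ k → sign j * sign k * term a b j k) ∎)

      term-sym : ∀ a b p q → p Fin.≤ q → term a b (inject₁ p) q ≈ term b a (suc q) p
      term-sym a b p q p≤q = *-cong
        (trans (*-comm _ _) (reflexive (≡.cong₂ (λ i j → b i * a j) (punchIn-inject₁ p q p≤q) (≡.sym (punchIn-suc p q p≤q)))))
        (det-cong λ i l → reflexive (≡.cong (M i) (punchIn-comm p q p≤q l)))

    det-equal-first-rows : ∀ a → Det (a ∷ a ∷ M) ≈ 0#
    det-equal-first-rows a = trans (det-two-rows a a) (alternating-sum _ (term a a) (term-sym a a))

    det-swap-first-rows : ∀ a b → Det (a ∷ b ∷ M) ≈ - Det (b ∷ a ∷ M)
    det-swap-first-rows a b = begin
      Det (a ∷ b ∷ M)
        ≈⟨ solve 2 (λ x y → x := (x :+ y) :- y) refl _ _ ⟩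
      Det (a ∷ b ∷ M) + Det (b ∷ a ∷ M) - Det (b ∷ a ∷ M)
        ≈⟨ +-congʳ cancel ⟩
      0# - Det (b ∷ a ∷ M)
        ≈⟨ +-identityˡ _ ⟩
      - Det (b ∷ a ∷ M) ∎
      where
      cancel : Det (a ∷ b ∷ M) + Det (b ∷ a ∷ M) ≈ 0#
      cancel = begin
        Det (a ∷ b ∷ M) + Det (b ∷ a ∷ M)
          ≈⟨ +-cong (det-two-rows a b) (det-two-rows b a) ⟩
        ∑ (λ j → ∑ (λ k → sign j * sign k * term a b j k)) + ∑ (λ j → ∑ (λ k → sign j * sign k * term b a j k))
          ≈⟨ ∑-+ _ _ ⟨
        ∑ (λ j → ∑ (λ k → sign j * sign k * term a b j k) + ∑ (λ k → sign j * sign k * term b a j k))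
          ≈⟨ ∑-cong (λ j → trans (sym (∑-+ _ _)) (∑-cong λ k → sym (distribˡ _ _ _))) ⟩
        ∑ (λ j → ∑ (λ k → sign j * sign k * (term a b j k + term b a j k)))
          ≈⟨ alternating-sum _ (λ j k → term a b j k + term b a j k)
               (λ p q p≤q → trans (+-cong (term-sym a b p q p≤q) (term-sym b a p q p≤q)) (+-comm _ _)) ⟩
        0# ∎

  det-cong-minors : ∀ {n} (a : Fin (suc n) → Carrier) {M N : Fin n → Fin (suc n) → Carrier} →
                    (∀ j → Det (deleteColumn M j) ≈ Det (deleteColumn N j)) → Det (a ∷ M) ≈ Det (a ∷ N)
  det-cong-minors a {M} {N} M≈N = trans (reflexive (Det-expand (a ∷ M)))
    (trans (∑-cong λ j → *-congˡ (M≈N j)) (reflexive (≡.sym (Det-expand (a ∷ N)))))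

  -- Swapping the first two rows moves the repetition into the minors, unless it
  -- is among these two rows.

  det-repeated-row : ∀ {n} (M : Fin n → Fin (suc n) → Carrier) k → Det (M k ∷ M) ≈ 0#
  det-repeated-row {suc n} M zero = begin
    Det (M zero ∷ M)                      ≈⟨ det-cong (λ { zero j → refl ; (suc zero) j → refl ; (suc (suc i)) j → refl }) ⟩
    Det (M zero ∷ M zero ∷ tail M)        ≈⟨ det-equal-first-rows (tail M) (M zero) ⟩
    0#                                    ∎
  det-repeated-row {suc n} M (suc k) = begin
    Det (M (suc k) ∷ M)
      ≈⟨ det-cong (λ { zero j → refl ; (suc zero) j → refl ; (suc (suc i)) j → refl }) ⟩
    Det (M (suc k) ∷ M zero ∷ tail M)
      ≈⟨ det-swap-first-rows (tail M) (M (suc k)) (M zero) ⟩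
    - Det (M zero ∷ M (suc k) ∷ tail M)
      ≈⟨ -‿cong (trans (reflexive (Det-expand _)) (∑-zero λ j → trans (*-congˡ (repeated j)) (zeroʳ _))) ⟩
    - 0#
      ≈⟨ solve 0 (:- :0 := :0) refl ⟩
    0# ∎
    where
    repeated : ∀ j → Det (deleteColumn (M (suc k) ∷ tail M) j) ≈ 0#
    repeated j = begin
      Det (deleteColumn (M (suc k) ∷ tail M) j)  ≈⟨ det-cong (λ { zero l → refl ; (suc i) l → refl }) ⟩
      Det (N k ∷ N)                              ≈⟨ det-repeated-row N k ⟩
      0#                                         ∎
      where
      N = deleteColumn (tail M) j

  -- Row operations

  -- A combination of the other rows is added to the first row.

  det-add-to-first-row : ∀ {n} (a : Fin (suc n) → Carrier) (x : Fin n → Carrier) (M : Fin n → Fin (suc n) → Carrier) →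
                         Det ((λ j → a j + ∑ (λ k → x k * M k j)) ∷ M) ≈ Det (a ∷ M)
  det-add-to-first-row a x M = begin
    Det ((λ j → a j + ∑ (λ k → x k * M k j)) ∷ M)
      ≈⟨ det-first-row-+ a _ M ⟩
    Det (a ∷ M) + Det ((λ j → ∑ (λ k → x k * M k j)) ∷ M)
      ≈⟨ +-congˡ (det-first-row-∑ x M M) ⟩
    Det (a ∷ M) + ∑ (λ k → x k * Det (M k ∷ M))
      ≈⟨ +-congˡ (∑-zero λ k → trans (*-congˡ (det-repeated-row M k)) (zeroʳ _)) ⟩
    Det (a ∷ M) + 0#
      ≈⟨ +-identityʳ _ ⟩
    Det (a ∷ M) ∎

  -- Multiples of the first row are added to the other rows.

  det-add-first-row : ∀ {n} (a : Fin (suc n) → Carrier) (x : Fin n → Carrier) (M : Fin n → Fin (suc n) → Carrier) →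
                      Det (a ∷ λ i j → M i j + x i * a j) ≈ Det (a ∷ M)
  det-add-first-row {zero}  a x M = det-cong λ { zero j → refl }
  det-add-first-row {suc n} a x M = begin
    Det (a ∷ λ i j → M i j + x i * a j)
      ≈⟨ det-cong (λ { zero j → refl ; (suc zero) j → refl ; (suc (suc i)) j → refl }) ⟩
    Det (a ∷ (λ j → M zero j + x zero * a j) ∷ M′)
      ≈⟨ det-swap-first-rows M′ _ _ ⟩
    - Det ((λ j → M zero j + x zero * a j) ∷ a ∷ M′)
      ≈⟨ -‿cong (trans (det-first-row-+ _ _ _) (+-congˡ (det-first-row-* _ _ _))) ⟩
    - (Det (M zero ∷ a ∷ M′) + x zero * Det (a ∷ a ∷ M′))
      ≈⟨ -‿cong (+-cong (det-cong-minors (M zero) {a ∷ M′} {a ∷ tail M} minors) (*-congˡ (det-equal-first-rows M′ a))) ⟩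
    - (Det (M zero ∷ a ∷ tail M) + x zero * 0#)
      ≈⟨ solve 2 (λ d x → :- (d :+ x :* :0) := :- d) refl _ _ ⟩
    - Det (M zero ∷ a ∷ tail M)
      ≈⟨ det-swap-first-rows (tail M) a (M zero) ⟨
    Det (a ∷ M zero ∷ tail M)
      ≈⟨ det-cong (λ { zero j → refl ; (suc zero) j → refl ; (suc (suc i)) j → refl }) ⟩
    Det (a ∷ M) ∎
    where
    M′ : Fin n → Fin (suc (suc n)) → Carrier
    M′ i j = M (suc i) j + x (suc i) * a j
    minors : ∀ j → Det (deleteColumn (a ∷ M′) j) ≈ Det (deleteColumn (a ∷ tail M) j)
    minors j = begin
      Det (deleteColumn (a ∷ M′) j)
        ≈⟨ det-cong (λ { zero l → refl ; (suc i) l → refl }) ⟩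
      Det ((λ l → a (punchIn j l)) ∷ λ i l → M (suc i) (punchIn j l) + x (suc i) * a (punchIn j l))
        ≈⟨ det-add-first-row (λ l → a (punchIn j l)) (x ∘ suc) (deleteColumn (tail M) j) ⟩
      Det ((λ l → a (punchIn j l)) ∷ deleteColumn (tail M) j)
        ≈⟨ det-cong (λ { zero l → refl ; (suc i) l → refl }) ⟩
      Det (deleteColumn (a ∷ tail M) j) ∎

  -- Combinations of the last l rows are added to the first k rows.

  det-add-lower-rows : ∀ k {l} {M N : Matrix (k ℕ.+ l)} (X : Fin k → Fin l → Carrier) →
    (∀ i j → N (i ↑ˡ l) j ≈ M (i ↑ˡ l) j + ∑ (λ t → X i t * M (k ↑ʳ t) j)) →
    (∀ i j → N (k ↑ʳ i) j ≈ M (k ↑ʳ i) j) →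
    Det N ≈ Det M
  det-add-lower-rows zero    X top bottom = det-cong bottom
  det-add-lower-rows (suc k) {l} {M} {N} X top bottom = begin
    Det N
      ≡⟨ Det-expand N ⟩
    ∑ (λ j → sign j * N zero j * Det (deleteColumn (tail N) j))
      ≈⟨ ∑-cong (λ j → *-cong (*-congˡ (first j)) (det-add-lower-rows k (X ∘ suc)
           (λ i u → top (suc i) (punchIn j u)) (λ i u → bottom i (punchIn j u)))) ⟩
    ∑ (λ j → sign j * (M zero j + ∑ (λ u → x u * M (suc u) j)) * Det (deleteColumn (tail M) j))
      ≡⟨ Det-expand _ ⟨
    Det ((λ j → M zero j + ∑ (λ u → x u * M (suc u) j)) ∷ tail M)
      ≈⟨ det-add-to-first-row (M zero) x (tail M) ⟩
    Det (M zero ∷ tail M)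
      ≈⟨ det-cong (λ { zero j → refl ; (suc i) j → refl }) ⟩
    Det M ∎
    where
    x : Fin (k ℕ.+ l) → Carrier
    x u = [ (λ _ → 0#) , X zero ]′ (splitAt k u)
    first : ∀ j → N zero j ≈ M zero j + ∑ (λ u → x u * M (suc u) j)
    first j = trans (top zero j) (+-congˡ (sym (begin
      ∑ (λ u → x u * M (suc u) j)
        ≈⟨ ∑-↑ k (λ u → x u * M (suc u) j) ⟩
      ∑ (λ i → x (i ↑ˡ l) * M (suc (i ↑ˡ l)) j) + ∑ (λ t → x (k ↑ʳ t) * M (suc (k ↑ʳ t)) j)
        ≈⟨ +-cong (∑-zero λ i → trans (*-congʳ (reflexive (≡.cong [ _ , _ ]′ (splitAt-↑ˡ k i l)))) (zeroˡ _))
                  (∑-cong λ t → *-congʳ (reflexive (≡.cong [ _ , _ ]′ (splitAt-↑ʳ k l t)))) ⟩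
      0# + ∑ (λ t → X zero t * M (suc (k ↑ʳ t)) j)
        ≈⟨ +-identityˡ _ ⟩
      ∑ (λ t → X zero t * M (suc (k ↑ʳ t)) j) ∎)))

  -- Block matrices

  -- Matrices ( A 0 ; C D )

  det-lower-triangular : ∀ k {l} (M : Matrix (k ℕ.+ l)) →
    (∀ i j → M (i ↑ˡ l) (k ↑ʳ j) ≈ 0#) →
    Det M ≈ Det (λ i j → M (i ↑ˡ l) (j ↑ˡ l)) * Det (λ i j → M (k ↑ʳ i) (k ↑ʳ j))
  det-lower-triangular zero    M upper = sym (trans (*-congʳ (reflexive (Det-[] _))) (*-identityˡ _))
  det-lower-triangular (suc k) {l} M upper = begin
    Det M
      ≡⟨ Det-expand M ⟩
    ∑ (term M)
      ≈⟨ ∑-↑ (suc k) (term M) ⟩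
    ∑ (λ j → term M (j ↑ˡ l)) + ∑ (λ j → term M (suc k ↑ʳ j))
      ≈⟨ +-cong (∑-cong left) (∑-zero λ j → trans (*-congʳ (trans (*-congˡ (upper zero j)) (zeroʳ _))) (zeroˡ _)) ⟩
    ∑ (λ j → sign j * A zero j * Det (deleteColumn (tail A) j) * Det D) + 0#
      ≈⟨ +-identityʳ _ ⟩
    ∑ (λ j → sign j * A zero j * Det (deleteColumn (tail A) j) * Det D)
      ≈⟨ ∑-*ʳ _ (Det D) ⟩
    ∑ (λ j → sign j * A zero j * Det (deleteColumn (tail A) j)) * Det D
      ≡⟨ ≡.cong (_* Det D) (Det-expand A) ⟨
    Det A * Det D ∎
    where
    A : Matrix (suc k)
    A i j = M (i ↑ˡ l) (j ↑ˡ l)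
    D : Matrix l
    D i j = M (suc k ↑ʳ i) (suc k ↑ʳ j)
    term : Matrix (suc k ℕ.+ l) → Fin (suc k ℕ.+ l) → Carrier
    term M j = sign j * M zero j * Det (deleteColumn (tail M) j)
    minor : ∀ j → Det (deleteColumn (tail M) (j ↑ˡ l)) ≈ Det (deleteColumn (tail A) j) * Det D
    minor j = trans
      (det-lower-triangular k (deleteColumn (tail M) (j ↑ˡ l))
        (λ i u → trans (reflexive (≡.cong (M _) (punchIn-↑ʳ k j u))) (upper (suc i) u)))
      (*-cong (det-cong λ i u → reflexive (≡.cong (M _) (punchIn-↑ˡ l j u)))
              (det-cong λ i u → reflexive (≡.cong (M _) (punchIn-↑ʳ k j u))))
    left : ∀ j → term M (j ↑ˡ l) ≈ sign j * A zero j * Det (deleteColumn (tail A) j) * Det D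
    left j = begin
      (- 1#) ^ toℕ (j ↑ˡ l) * A zero j * Det (deleteColumn (tail M) (j ↑ˡ l))
        ≈⟨ *-cong (*-congʳ (reflexive (≡.cong ((- 1#) ^_) (Fin.toℕ-↑ˡ j l)))) (minor j) ⟩
      sign j * A zero j * (Det (deleteColumn (tail A) j) * Det D)
        ≈⟨ *-assoc _ _ _ ⟨
      sign j * A zero j * Det (deleteColumn (tail A) j) * Det D ∎

  -- Block elimination without division.  In ( A B ; C D ) the upper rows are
  -- scaled by the diagonal matrix s, and X times the lower rows is subtracted,
  -- where s B = X D.

  det-eliminate : ∀ k {l} (M : Matrix (k ℕ.+ l)) (s : Fin k → Carrier) (X : Fin k → Fin l → Carrier) →
    (∀ i j → s i * M (i ↑ˡ l) (k ↑ʳ j) ≈ ∑ (λ t → X i t * M (k ↑ʳ t) (k ↑ʳ j))) →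
    product s * Det M ≈
      Det (λ i j → s i * M (i ↑ˡ l) (j ↑ˡ l) - ∑ (λ t → X i t * M (k ↑ʳ t) (j ↑ˡ l))) *
      Det (λ i j → M (k ↑ʳ i) (k ↑ʳ j))
  det-eliminate k {l} M s X eliminates = begin
    product s * Det M
      ≈⟨ *-congʳ product-s ⟨
    product s′ * Det M
      ≈⟨ det-rows-* s′ M ⟨
    Det (λ i j → s′ i * M i j)
      ≈⟨ det-add-lower-rows k {M = λ i j → s′ i * M i j} {N} (λ i t → - X i t) top bottom ⟨
    Det N
      ≈⟨ det-lower-triangular k N (λ i j → trans (N-top i _) (trans (+-congʳ (eliminates i j)) (-‿inverseʳ _))) ⟩
    Det (λ i j → N (i ↑ˡ l) (j ↑ˡ l)) * Det (λ i j → N (k ↑ʳ i) (k ↑ʳ j))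
      ≈⟨ *-cong (det-cong λ i j → N-top i (j ↑ˡ l)) (det-cong λ i j → N-bottom i (k ↑ʳ j)) ⟩
    Det (λ i j → s i * M (i ↑ˡ l) (j ↑ˡ l) - ∑ (λ t → X i t * M (k ↑ʳ t) (j ↑ˡ l))) *
      Det (λ i j → M (k ↑ʳ i) (k ↑ʳ j)) ∎
    where
    s′ : Fin (k ℕ.+ l) → Carrier
    s′ u = [ s , (λ _ → 1#) ]′ (splitAt k u)
    s′-top : ∀ i → s′ (i ↑ˡ l) ≡ s i
    s′-top i = ≡.cong [ s , _ ]′ (splitAt-↑ˡ k i l)
    s′-bottom : ∀ i → s′ (k ↑ʳ i) ≡ 1#
    s′-bottom i = ≡.cong [ s , _ ]′ (splitAt-↑ʳ k l i)
    N : Matrix (k ℕ.+ l)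
    N u j = [ (λ i → s i * M (i ↑ˡ l) j - ∑ (λ t → X i t * M (k ↑ʳ t) j)) , (λ i → M (k ↑ʳ i) j) ]′ (splitAt k u)
    N-top : ∀ i j → N (i ↑ˡ l) j ≈ s i * M (i ↑ˡ l) j - ∑ (λ t → X i t * M (k ↑ʳ t) j)
    N-top i j = reflexive (≡.cong [ _ , _ ]′ (splitAt-↑ˡ k i l))
    N-bottom : ∀ i j → N (k ↑ʳ i) j ≈ M (k ↑ʳ i) j
    N-bottom i j = reflexive (≡.cong [ _ , _ ]′ (splitAt-↑ʳ k l i))
    s′-bottom-* : ∀ i z → s′ (k ↑ʳ i) * z ≈ z
    s′-bottom-* i z = trans (*-congʳ (reflexive (s′-bottom i))) (*-identityˡ z)
    top : ∀ i j → N (i ↑ˡ l) j ≈ s′ (i ↑ˡ l) * M (i ↑ˡ l) j + ∑ (λ t → - X i t * (s′ (k ↑ʳ t) * M (k ↑ʳ t) j))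
    top i j = trans (N-top i j) (+-cong (*-congʳ (reflexive (≡.sym (s′-top i)))) (trans (sym (∑-neg _))
      (∑-cong λ t → trans (-‿distribˡ-* _ _) (*-congˡ (sym (s′-bottom-* t _))))))
    bottom : ∀ i j → N (k ↑ʳ i) j ≈ s′ (k ↑ʳ i) * M (k ↑ʳ i) j
    bottom i j = trans (N-bottom i j) (sym (s′-bottom-* i _))
    product-s : product s′ ≈ product s
    product-s = begin
      product s′
        ≈⟨ product-↑ k s′ ⟩
      product (λ i → s′ (i ↑ˡ l)) * product (λ i → s′ (k ↑ʳ i))
        ≈⟨ *-cong (product-cong (reflexive ∘ s′-top)) (product-one (reflexive ∘ s′-bottom)) ⟩
      product s * 1#
        ≈⟨ *-identityʳ _ ⟩
      product s ∎

  det-first-block : ∀ {n} (M : Matrix (suc n)) → (∀ j → M zero (suc j) ≈ 0#) →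
                    Det M ≈ M zero zero * Det (λ i j → M (suc i) (suc j))
  det-first-block M upper = trans (det-lower-triangular 1 M (λ { zero j → upper j })) (*-congʳ (begin
    Det {1} (λ i j → M (i ↑ˡ _) (j ↑ˡ _))   ≡⟨ ≡.trans (Det-expand _) (≡.trans (∑-suc _) (≡.cong (λ s → 1# * M zero zero * Det _ + s) (∑-[] _))) ⟩
    1# * M zero zero * Det _ + 0#           ≡⟨ ≡.cong (λ d → 1# * M zero zero * d + 0#) (Det-[] _) ⟩
    1# * M zero zero * 1# + 0#              ≈⟨ solve 1 (λ x → :1 :* x :* :1 :+ :0 := x) refl _ ⟩
    M zero zero                             ∎))

  det-scalar : ∀ n x → Det (λ i j → x * identity {n} i j) ≈ x ^ n
  det-scalar zero    x = reflexive (Det-[] _)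
  det-scalar (suc n) x = begin
    Det (λ i j → x * identity {suc n} i j)
      ≈⟨ det-first-block (λ i j → x * identity i j) (λ j → zeroʳ x) ⟩
    x * 1# * Det (λ i j → x * identity {suc n} (suc i) (suc j))
      ≈⟨ *-cong (*-identityʳ x) (trans (det-cong λ i j → *-congˡ (reflexive (identity-injective Fin.suc-injective i j))) (det-scalar n x)) ⟩
    x * x ^ n ∎

  -- det (I ⊗ P) = det(P)ᵐ

  det-block-diagonal : ∀ m {k} (P : Matrix k) (M : Matrix (m ℕ.* k)) →
    (∀ (e : Fin m) w (e′ : Fin m) w′ → M (combine e w) (combine e′ w′) ≈ identity e e′ * P w w′) →
    Det M ≈ Det P ^ m
  det-block-diagonal zero    P M M≈ = reflexive (Det-[] M)
  det-block-diagonal (suc m) {k} P M M≈ = begin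
    Det M
      ≈⟨ det-lower-triangular k M upper ⟩
    Det (λ i j → M (i ↑ˡ m ℕ.* k) (j ↑ˡ m ℕ.* k)) * Det (λ i j → M (k ↑ʳ i) (k ↑ʳ j))
      ≈⟨ *-cong (det-cong λ w w′ → trans (M≈ zero w zero w′) (*-identityˡ _))
                (det-block-diagonal m P (λ i j → M (k ↑ʳ i) (k ↑ʳ j)) λ e w e′ w′ →
                   trans (M≈ (suc e) w (suc e′) w′)
                         (*-congʳ (reflexive (identity-injective Fin.suc-injective e e′)))) ⟩
    Det P * Det P ^ m ∎
    where
    upper : ∀ w u → M (w ↑ˡ m ℕ.* k) (k ↑ʳ u) ≈ 0#
    upper w u = begin
      M (w ↑ˡ m ℕ.* k) (k ↑ʳ u)
        ≡⟨ ≡.cong (λ u → M (w ↑ˡ m ℕ.* k) (k ↑ʳ u)) (combine-remQuot {m} k u) ⟨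
      M (combine {suc m} zero w) (combine (suc e′) w′)
        ≈⟨ M≈ zero w (suc e′) w′ ⟩
      0# * P w w′
        ≈⟨ zeroˡ _ ⟩
      0# ∎
      where
      e′ = proj₁ (remQuot {m} k u)
      w′ = proj₂ (remQuot {m} k u)

  -- Expansion along a first column that vanishes below the diagonal.

  det-first-column : ∀ {n} (M : Matrix (suc n)) → (∀ i → M (suc i) zero ≈ 0#) →
                     Det M ≈ M zero zero * Det (λ i j → M (suc i) (suc j))
  det-first-column M below = begin
    Det M
      ≡⟨ ≡.trans (Det-expand M) (∑-suc _) ⟩
    1# * M zero zero * Det (λ i j → M (suc i) (suc j)) + ∑ (λ j → sign (suc j) * M zero (suc j) * Det (deleteColumn (tail M) (suc j)))
      ≈⟨ +-cong (*-congʳ (*-identityˡ _)) (∑-zero λ j → trans (*-congˡ (zero-column (tail M) j below)) (zeroʳ _)) ⟩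
    M zero zero * Det (λ i j → M (suc i) (suc j)) + 0#
      ≈⟨ +-identityʳ _ ⟩
    M zero zero * Det (λ i j → M (suc i) (suc j)) ∎
    where
    zero-column : ∀ {n} (N : Fin n → Fin (suc n) → Carrier) (j : Fin n) → (∀ i → N i zero ≈ 0#) →
                  Det (deleteColumn N (suc j)) ≈ 0#
    zero-column {suc n} N j N≈0 = trans (reflexive (≡.trans (Det-expand _) (∑-suc _))) (trans
      (+-cong (trans (*-congʳ (trans (*-congˡ (N≈0 zero)) (zeroʳ _))) (zeroˡ _))
              (∑-zero λ k → trans (*-congˡ (zero-column (deleteColumn (tail N) (suc j)) k (N≈0 ∘ suc))) (zeroʳ _)))
      (+-identityˡ 0#))

  -- Adding all rows to the first one makes it constant.  A unit first row can
  -- then be used to remove the constant b from the other rows.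

  det-constant-column-sums : ∀ {n} (M : Matrix (suc n)) t b → (∀ j → ∑ (λ i → M i j) ≈ t) →
    Det (λ i j → M i j + b) ≈ (t + ι (suc n) * b) * Det ((λ _ → 1#) ∷ tail M)
  det-constant-column-sums {n} M t b column-sums = begin
    Det (λ i j → M i j + b)
      ≈⟨ det-cong (λ { zero j → refl ; (suc i) j → refl }) ⟩
    Det ((λ j → M zero j + b) ∷ λ i j → M (suc i) j + b)
      ≈⟨ det-add-to-first-row _ (λ _ → 1#) _ ⟨
    Det ((λ j → M zero j + b + ∑ (λ k → 1# * (M (suc k) j + b))) ∷ λ i j → M (suc i) j + b)
      ≈⟨ det-cong (λ { zero j → total j ; (suc i) j → +-congˡ (sym (*-identityʳ b)) }) ⟩
    Det ((λ j → (t + ι (suc n) * b) * 1#) ∷ λ i j → M (suc i) j + b * 1#)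
      ≈⟨ det-first-row-* _ _ _ ⟩
    (t + ι (suc n) * b) * Det ((λ _ → 1#) ∷ λ i j → M (suc i) j + b * 1#)
      ≈⟨ *-congˡ (det-add-first-row (λ _ → 1#) (λ _ → b) (tail M)) ⟩
    (t + ι (suc n) * b) * Det ((λ _ → 1#) ∷ tail M) ∎
    where
    total : ∀ j → M zero j + b + ∑ (λ k → 1# * (M (suc k) j + b)) ≈ (t + ι (suc n) * b) * 1#
    total j = begin
      M zero j + b + ∑ (λ k → 1# * (M (suc k) j + b))
        ≈⟨ +-congˡ (trans (∑-cong λ k → *-identityˡ _) (trans (∑-+ _ _) (+-congˡ (∑-const n b)))) ⟩
      M zero j + b + (∑ (λ k → M (suc k) j) + ι n * b)
        ≈⟨ solve 4 (λ m b s n → m :+ b :+ (s :+ n :* b) := m :+ s :+ (:1 :+ n) :* b) refl (M zero j) b _ (ι n) ⟩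
      M zero j + ∑ (λ k → M (suc k) j) + ι (suc n) * b
        ≈⟨ +-congʳ (trans (reflexive (≡.sym (∑-suc _))) (column-sums j)) ⟩
      t + ι (suc n) * b
        ≈⟨ *-identityʳ _ ⟨
      (t + ι (suc n) * b) * 1# ∎


-- Adjacency and incidence matrices

-- The selection of the pairs that are listed as edges.

isEdge : ∀ {n} → Graph (Fin n) → Fin n × Fin n → Bool
isEdge G (u , v) = does (u <? v) ∧ adj G u v

edge-ends-≢ : ∀ {n} (G : Graph (Fin n)) e → let (p , q) = lookup (edges G) e in p ≢ q
edge-ends-≢ {n} G e = <⇒≢ (ℕ.<ᵇ⇒< _ _ (proj₁ (Equivalence.to T-∧ (proj₂
  (∈-filter⁻ (T? ∘ isEdge G) {xs = cartesianProduct (allFin n) (allFin n)} (∈-lookup e))))))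

module GraphSums {c ℓ} (R : CommutativeRing c ℓ) where
  open CommutativeRing R hiding (zero)
  open Matrices R
  open IntegerSolver R
  open Determinant R
  open Relation.Binary.Reasoning.Setoid setoid

  indicator : Bool → Carrier
  indicator b = if b then 1# else 0#

  indicator-∧ : ∀ a b → indicator (a ∧ b) ≈ indicator a * indicator b
  indicator-∧ true  b = sym (*-identityˡ _)
  indicator-∧ false b = sym (zeroˡ _)

  -- Sums over the entries of a list, with multiplicity.

  ∑∈ : ∀ {a} {A : Set a} → List A → (A → Carrier) → Carrier
  ∑∈ xs f = ∑ (λ i → f (lookup xs i))

  module _ {a} {A : Set a} where

    ∑∈-++ : ∀ xs ys (f : A → Carrier) → ∑∈ (xs List.++ ys) f ≈ ∑∈ xs f + ∑∈ ys f
    ∑∈-++ List.[]     ys f = sym (trans (+-congʳ (reflexive (∑-[] _))) (+-identityˡ _))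
    ∑∈-++ (x List.∷ xs) ys f = begin
      ∑∈ (x List.∷ xs List.++ ys) f              ≡⟨ ∑-suc _ ⟩
      f x + ∑∈ (xs List.++ ys) f            ≈⟨ +-congˡ (∑∈-++ xs ys f) ⟩
      f x + (∑∈ xs f + ∑∈ ys f)        ≈⟨ +-assoc _ _ _ ⟨
      f x + ∑∈ xs f + ∑∈ ys f          ≡⟨ ≡.cong (_+ ∑∈ ys f) (∑-suc _) ⟨
      ∑∈ (x List.∷ xs) f + ∑∈ ys f          ∎

    ∑∈-map : ∀ {b} {B : Set b} (g : B → A) xs (f : A → Carrier) → ∑∈ (List.map g xs) f ≈ ∑∈ xs (f ∘ g)
    ∑∈-map g List.[]     f = reflexive (≡.trans (∑-[] _) (≡.sym (∑-[] _)))
    ∑∈-map g (x List.∷ xs) f = begin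
      ∑∈ (List.map g (x List.∷ xs)) f        ≡⟨ ∑-suc _ ⟩
      f (g x) + ∑∈ (List.map g xs) f    ≈⟨ +-congˡ (∑∈-map g xs f) ⟩
      f (g x) + ∑∈ xs (f ∘ g)           ≡⟨ ∑-suc _ ⟨
      ∑∈ (x List.∷ xs) (f ∘ g)               ∎

    ∑∈-tabulate : ∀ {n} (g : Fin n → A) (f : A → Carrier) → ∑∈ (List.tabulate g) f ≈ ∑ (f ∘ g)
    ∑∈-tabulate {zero}  g f = reflexive (≡.trans (∑-[] _) (≡.sym (∑-[] _)))
    ∑∈-tabulate {suc n} g f = begin
      ∑∈ (List.tabulate g) f                       ≡⟨ ∑-suc _ ⟩
      f (g zero) + ∑∈ (List.tabulate (g ∘ suc)) f  ≈⟨ +-congˡ (∑∈-tabulate (g ∘ suc) f) ⟩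
      f (g zero) + ∑ (f ∘ g ∘ suc)                 ≡⟨ ∑-suc _ ⟨
      ∑ (f ∘ g)                                    ∎

    ∑∈-filterᵇ : ∀ p xs (f : A → Carrier) → ∑∈ (filterᵇ p xs) f ≈ ∑∈ xs (λ x → indicator (p x) * f x)
    ∑∈-filterᵇ p List.[]     f = reflexive (≡.trans (∑-[] _) (≡.sym (∑-[] _)))
    ∑∈-filterᵇ p (x List.∷ xs) f = trans step (reflexive (≡.sym (∑-suc _)))
      where
      step : ∑∈ (filterᵇ p (x List.∷ xs)) f ≈ indicator (p x) * f x + ∑∈ xs (λ x → indicator (p x) * f x)
      step with p x
      ... | true  = trans (reflexive (∑-suc _)) (+-cong (sym (*-identityˡ _)) (∑∈-filterᵇ p xs f))
      ... | false = trans (∑∈-filterᵇ p xs f) (sym (trans (+-congʳ (zeroˡ _)) (+-identityˡ _)))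

  ∑∈-cartesianProduct : ∀ {a b} {A : Set a} {B : Set b} xs ys (f : A × B → Carrier) →
    ∑∈ (cartesianProduct xs ys) f ≈ ∑∈ xs (λ x → ∑∈ ys (λ y → f (x , y)))
  ∑∈-cartesianProduct List.[]     ys f = reflexive (≡.trans (∑-[] _) (≡.sym (∑-[] _)))
  ∑∈-cartesianProduct (x List.∷ xs) ys f = begin
    ∑∈ (cartesianProduct (x List.∷ xs) ys) f
      ≈⟨ ∑∈-++ (List.map (x ,_) ys) (cartesianProduct xs ys) f ⟩
    ∑∈ (List.map (x ,_) ys) f + ∑∈ (cartesianProduct xs ys) f
      ≈⟨ +-cong (∑∈-map (x ,_) ys f) (∑∈-cartesianProduct xs ys f) ⟩
    ∑∈ ys (λ y → f (x , y)) + ∑∈ xs (λ x → ∑∈ ys (λ y → f (x , y)))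
      ≡⟨ ∑-suc _ ⟨
    ∑∈ (x List.∷ xs) (λ x → ∑∈ ys (λ y → f (x , y))) ∎

  -- Degrees

  ι-count : ∀ {n} (f : Fin n → Bool) → ι ∣ Vec.tabulate f ∣ ≈ ∑ (indicator ∘ f)
  ι-count {zero}  f = reflexive (≡.sym (∑-[] _))
  ι-count {suc n} f = trans (step (f zero)) (reflexive (≡.sym (∑-suc _)))
    where
    step : ∀ b → ι ∣ b Vec.∷ Vec.tabulate (f ∘ suc) ∣ ≈ indicator b + ∑ (indicator ∘ f ∘ suc)
    step true  = +-congˡ (ι-count (f ∘ suc))
    step false = trans (ι-count (f ∘ suc)) (sym (+-identityˡ _))

  module _ {n} (G : Graph (Fin n)) where

    ι-degree : ∀ v → ι (degree G v) ≈ ∑ (adjacency G v)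
    ι-degree v = ι-count (adj G v)

    adjacency-sym : ∀ u v → adjacency G u v ≡ adjacency G v u
    adjacency-sym u v = ≡.cong indicator (adj-sym G u v)

    laplacian-column-sum : ∀ v → ∑ (λ u → laplacian G u v) ≈ 0#
    laplacian-column-sum v = begin
      ∑ (λ u → ι (degree G u) * identity u v - adjacency G u v)
        ≈⟨ ∑-+ _ _ ⟩
      ∑ (λ u → ι (degree G u) * identity u v) + ∑ (λ u → - adjacency G u v)
        ≈⟨ +-cong (∑-cong λ u → trans (*-comm _ _) (*-congʳ (reflexive (identity-sym u v)))) (∑-neg _) ⟩
      ∑ (λ u → identity v u * ι (degree G u)) - ∑ (λ u → adjacency G u v)
        ≈⟨ +-cong (∑-identity v _) (-‿cong (∑-cong λ u → reflexive (adjacency-sym u v))) ⟩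
      ι (degree G v) - ∑ (adjacency G v)
        ≈⟨ +-congʳ (ι-degree v) ⟩
      ∑ (adjacency G v) - ∑ (adjacency G v)
        ≈⟨ -‿inverseʳ _ ⟩
      0# ∎

    -- The incidence matrix; its columns are numbered like the list of edges.

    incidence : Fin n → Fin (size G) → Carrier
    incidence v e = indicator (v ∈ₑ lookup (edges G) e)

    private
      -- the incidence of v with the edge from p to q, as a sum
      ends : Fin n → Fin n × Fin n → Carrier
      ends v (p , q) = identity v p + identity v q

      -- the part of the adjacency matrix above the diagonal
      oriented : Fin n → Fin n → Carrier
      oriented p q = indicator (isEdge G (p , q))

    -- The two ends of an edge are distinct, so at most one summand is 1.

    incidence≈ends : ∀ v e → incidence v e ≈ ends v (lookup (edges G) e)
    incidence≈ends v e with v ≟ proj₁ (lookup (edges G) e) | v ≟ proj₂ (lookup (edges G) e)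
    ... | yes v≡p | yes v≡q = contradiction (≡.trans (≡.sym v≡p) v≡q) (edge-ends-≢ G e)
    ... | yes _   | no  _   = sym (+-identityʳ _)
    ... | no  _   | yes _   = sym (+-identityˡ _)
    ... | no  _   | no  _   = sym (+-identityˡ _)

    ∑-edges : (f : Fin n × Fin n → Carrier) →
              ∑∈ (edges G) f ≈ ∑ (λ p → ∑ (λ q → oriented p q * f (p , q)))
    ∑-edges f = begin
      ∑∈ (edges G) f
        ≈⟨ ∑∈-filterᵇ (isEdge G) (cartesianProduct (allFin n) (allFin n)) f ⟩
      ∑∈ (cartesianProduct (allFin n) (allFin n)) (λ e → indicator (isEdge G e) * f e)
        ≈⟨ ∑∈-cartesianProduct (allFin n) (allFin n) (λ e → indicator (isEdge G e) * f e) ⟩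
      ∑∈ (allFin n) (λ p → ∑∈ (allFin n) (λ q → oriented p q * f (p , q)))
        ≈⟨ ∑∈-tabulate (λ p → p) _ ⟩
      ∑ (λ p → ∑∈ (allFin n) (λ q → oriented p q * f (p , q)))
        ≈⟨ ∑-cong (λ p → ∑∈-tabulate (λ q → q) _) ⟩
      ∑ (λ p → ∑ (λ q → oriented p q * f (p , q))) ∎

    oriented-+ : ∀ p q → oriented p q + oriented q p ≈ adjacency G p q
    oriented-+ p q with <-cmp p q
    ... | tri< p<q _ q≮p rewrite dec-true (p <? q) p<q | dec-false (q <? p) q≮p = +-identityʳ _
    ... | tri> p≮q _ q<p rewrite dec-false (p <? q) p≮q | dec-true (q <? p) q<p | adj-sym G p q = +-identityˡ _
    ... | tri≈ p≮p ≡.refl _ rewrite dec-false (p <? p) p≮p | adj-irrefl G p = +-identityˡ _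

    -- B Bᵀ = D + A, where D is the diagonal matrix of degrees.

    incidence-gram : ∀ u v → ∑ (λ e → incidence u e * incidence v e) ≈
                             ι (degree G u) * identity u v + adjacency G u v
    incidence-gram u v = begin
      ∑ (λ e → incidence u e * incidence v e)
        ≈⟨ ∑-cong (λ e → *-cong (incidence≈ends u e) (incidence≈ends v e)) ⟩
      ∑∈ (edges G) (λ e → ends u e * ends v e)
        ≈⟨ ∑-edges _ ⟩
      ∑ (λ p → ∑ (λ q → oriented p q * ((δ u p + δ u q) * (δ v p + δ v q))))
        ≈⟨ ∑-cong (λ p → trans (∑-cong λ q → solve 5
             (λ o a b c d → o :* ((a :+ b) :* (c :+ d)) :=
               a :* (c :* o) :+ b :* (d :* o) :+ (a :* (d :* o) :+ b :* (c :* o)))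
             refl (oriented p q) (δ u p) (δ u q) (δ v p) (δ v q)) (split _ _ _ _)) ⟩
      ∑ (λ p → S₁ p + S₂ p + (S₃ p + S₄ p))
        ≈⟨ split _ _ _ _ ⟩
      ∑ S₁ + ∑ S₂ + (∑ S₃ + ∑ S₄)
        ≈⟨ +-cong (+-cong
             (trans (∑-cong λ p → ∑-*ˡ _ _) (∑-identity u _))
             (∑-cong λ p → ∑-identity u _))
           (+-cong
             (trans (∑-cong λ p → trans (∑-*ˡ _ _) (*-congˡ (∑-identity v _))) (∑-identity u _))
             (trans (∑-cong λ p → ∑-identity u _) (∑-identity v _))) ⟩
      ∑ (λ q → δ v u * oriented u q) + ∑ (λ p → δ v u * oriented p u) + (oriented u v + oriented v u)
        ≈⟨ +-cong (sym (∑-+ _ _)) (oriented-+ u v) ⟩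
      ∑ (λ q → δ v u * oriented u q + δ v u * oriented q u) + adjacency G u v
        ≈⟨ +-congʳ (∑-cong λ q → trans (sym (distribˡ _ _ _)) (*-congˡ (oriented-+ u q))) ⟩
      ∑ (λ q → δ v u * adjacency G u q) + adjacency G u v
        ≈⟨ +-congʳ (∑-*ˡ _ _) ⟩
      δ v u * ∑ (adjacency G u) + adjacency G u v
        ≈⟨ +-congʳ (trans (*-comm _ _) (*-cong (sym (ι-degree u)) (reflexive (identity-sym v u)))) ⟩
      ι (degree G u) * identity u v + adjacency G u v ∎
      where
      δ : Fin n → Fin n → Carrier
      δ = identity
      S₁ S₂ S₃ S₄ : Fin n → Carrier
      S₁ p = ∑ (λ q → δ u p * (δ v p * oriented p q))
      S₂ p = ∑ (λ q → δ u q * (δ v q * oriented p q))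
      S₃ p = ∑ (λ q → δ u p * (δ v q * oriented p q))
      S₄ p = ∑ (λ q → δ u q * (δ v p * oriented p q))
      split : ∀ {n} (f g h k : Fin n → Carrier) →
              ∑ (λ q → f q + g q + (h q + k q)) ≈ ∑ f + ∑ g + (∑ h + ∑ k)
      split f g h k = trans (∑-+ _ _) (+-cong (∑-+ f g) (∑-+ h k))

    incidence-row-sum : ∀ v → ∑ (incidence v) ≈ ι (degree G v)
    incidence-row-sum v = begin
      ∑ (incidence v)
        ≈⟨ ∑-cong (λ e → sym (idempotent (v ∈ₑ lookup (edges G) e))) ⟩
      ∑ (λ e → incidence v e * incidence v e)
        ≈⟨ incidence-gram v v ⟩
      ι (degree G v) * identity v v + adjacency G v v
        ≈⟨ +-cong (*-congˡ (reflexive (identity-≡ v))) (reflexive (≡.cong indicator (adj-irrefl G v))) ⟩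
      ι (degree G v) * 1# + 0#
        ≈⟨ trans (+-identityʳ _) (*-identityʳ _) ⟩
      ι (degree G v) ∎
      where
      idempotent : ∀ b → indicator b * indicator b ≈ indicator b
      idempotent true  = *-identityˡ 1#
      idempotent false = zeroˡ 0#

    incidence-column-sum : ∀ e → ∑ (λ v → incidence v e) ≈ ι 2
    incidence-column-sum e = begin
      ∑ (λ v → incidence v e)
        ≈⟨ ∑-cong (λ v → incidence≈ends v e) ⟩
      ∑ (λ v → identity v p + identity v q)
        ≈⟨ ∑-+ _ _ ⟩
      ∑ (λ v → identity v p) + ∑ (λ v → identity v q)
        ≈⟨ +-cong (column p) (column q) ⟩
      1# + 1#
        ≈⟨ solve 0 (:1 :+ :1 := con (+ 2)) refl ⟩
      ι 2 ∎
      where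
      p q : Fin n
      p = proj₁ (lookup (edges G) e)
      q = proj₂ (lookup (edges G) e)
      column : ∀ p → ∑ (λ v → identity v p) ≈ 1#
      column p = trans (∑-cong λ v → trans (reflexive (identity-sym v p)) (sym (*-identityʳ _))) (∑-identity p (λ _ → 1#))

-- The determinant of the corona

↑-elim : ∀ {p} k {l} {P : Fin (k ℕ.+ l) → Set p} →
         (∀ i → P (i ↑ˡ l)) → (∀ i → P (k ↑ʳ i)) → ∀ i → P i
↑-elim zero    left right i       = right i
↑-elim (suc k) left right zero    = left zero
↑-elim (suc k) left right (suc i) = ↑-elim k (left ∘ suc) right i

↑ˡ≢↑ʳ : ∀ {k l} (i : Fin k) (j : Fin l) → i ↑ˡ l ≢ k ↑ʳ j
↑ˡ≢↑ʳ (suc i) j eq = ↑ˡ≢↑ʳ i j (Fin.suc-injective eq)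

module Corona {o ℓ} (R : CommutativeRing o ℓ) {n₁ n₂} (G₁ : Graph (Fin n₁)) (G₂ : Graph (Fin n₂))
              (r : ℕ) (regular : Regular r G₁) (x : CommutativeRing.Carrier R) where

  open CommutativeRing R hiding (zero)
  open Matrices R
  open IntegerSolver R
  open Determinant R
  open GraphSums R
  open Relation.Binary.Reasoning.Setoid setoid

  private
    m₁ = size G₁
    k  = n₁ ℕ.+ m₁
    N  = k ℕ.+ m₁ ℕ.* n₂
    A  = adjacency (G₁ ⊡ G₂)
    A₁ = adjacency G₁
    A₂ = adjacency G₂
    B  = incidence G₁

    y : Carrier
    y = x - ι 2

    -- The positions of the three kinds of vertices of the corona: vertex and edge
    -- number the vertices of the central graph, old and copy those of the corona.

    vertex : Fin n₁ → Fin k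
    vertex v = v ↑ˡ m₁

    edge : Fin m₁ → Fin k
    edge e = n₁ ↑ʳ e

    old : Fin k → Fin N
    old i = i ↑ˡ (m₁ ℕ.* n₂)

    copy : Fin m₁ → Fin n₂ → Fin N
    copy e w = k ↑ʳ combine {m₁} e w

    at-vertex : ∀ v → coronaVertex G₁ n₂ (old (vertex v)) ≡ inj₁ (inj₁ v)
    at-vertex v = ≡.trans (≡.cong (Sum.map (splitAt n₁) (remQuot n₂)) (splitAt-↑ˡ k (vertex v) _))
                          (≡.cong inj₁ (splitAt-↑ˡ n₁ v m₁))

    at-edge : ∀ e → coronaVertex G₁ n₂ (old (edge e)) ≡ inj₁ (inj₂ e)
    at-edge e = ≡.trans (≡.cong (Sum.map (splitAt n₁) (remQuot n₂)) (splitAt-↑ˡ k (edge e) _))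
                        (≡.cong inj₁ (splitAt-↑ʳ n₁ m₁ e))

    at-copy : ∀ e w → coronaVertex G₁ n₂ (copy e w) ≡ inj₂ (e , w)
    at-copy e w = ≡.trans (≡.cong (Sum.map (splitAt n₁) (remQuot n₂)) (splitAt-↑ʳ k (m₁ ℕ.* n₂) (combine {m₁} e w)))
                          (≡.cong inj₂ (remQuot-combine e w))

    A-at : ∀ {i j p q} → coronaVertex G₁ n₂ i ≡ p → coronaVertex G₁ n₂ j ≡ q →
           A i j ≡ indicator (adj (centralEdgeNbhdCorona G₁ G₂) p q)
    A-at = ≡.cong₂ (λ p q → indicator (adj (centralEdgeNbhdCorona G₁ G₂) p q))

    -- The blocks of the adjacency matrix

    A-vertex-vertex : ∀ u v → A (old (vertex u)) (old (vertex v)) ≈ 1# - identity u v - A₁ u v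
    A-vertex-vertex u v = trans (reflexive (A-at (at-vertex u) (at-vertex v))) nonadjacent
      where
      nonadjacent : indicator (not (does (u ≟ v)) ∧ not (adj G₁ u v)) ≈ 1# - identity u v - A₁ u v
      nonadjacent with u ≟ v
      ... | yes ≡.refl rewrite adj-irrefl G₁ u = solve 0 (:0 := :1 :- :1 :- :0) refl
      ... | no _ with adj G₁ u v
      ...   | true  = solve 0 (:0 := :1 :- :0 :- :1) refl
      ...   | false = solve 0 (:1 := :1 :- :0 :- :0) refl

    A-vertex-edge : ∀ v e → A (old (vertex v)) (old (edge e)) ≡ B v e
    A-vertex-edge v e = A-at (at-vertex v) (at-edge e)

    A-edge-vertex : ∀ e v → A (old (edge e)) (old (vertex v)) ≡ B v e
    A-edge-vertex e v = A-at (at-edge e) (at-vertex v)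

    A-edge-edge : ∀ e e′ → A (old (edge e)) (old (edge e′)) ≡ 0#
    A-edge-edge e e′ = A-at (at-edge e) (at-edge e′)

    A-vertex-copy : ∀ v e w → A (old (vertex v)) (copy e w) ≡ B v e
    A-vertex-copy v e w = A-at (at-vertex v) (at-copy e w)

    A-copy-vertex : ∀ e w v → A (copy e w) (old (vertex v)) ≡ B v e
    A-copy-vertex e w v = A-at (at-copy e w) (at-vertex v)

    A-edge-copy : ∀ e e′ w → A (old (edge e)) (copy e′ w) ≡ 0#
    A-edge-copy e e′ w = A-at (at-edge e) (at-copy e′ w)

    A-copy-edge : ∀ e w e′ → A (copy e w) (old (edge e′)) ≡ 0#
    A-copy-edge e w e′ = A-at (at-copy e w) (at-edge e′)

    A-copy-copy : ∀ e w e′ w′ → A (copy e w) (copy e′ w′) ≈ identity e e′ * A₂ w w′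
    A-copy-copy e w e′ w′ = trans (reflexive (A-at (at-copy e w) (at-copy e′ w′))) (indicator-∧ (does (e ≟ e′)) (adj G₂ w w′))

    -- Degrees

    ∑-vertices : (f : Fin N → Carrier) →
      ∑ f ≈ ∑ (λ v → f (old (vertex v))) + ∑ (λ e → f (old (edge e))) + ∑ (λ e → ∑ (λ w → f (copy e w)))
    ∑-vertices f = trans (∑-↑ k f) (+-cong (∑-↑ n₁ (λ i → f (old i))) (∑-combine m₁ _))

    -- the degree of a vertex of G₁ in the corona: n₁ − 1 − r non-neighbours,
    -- r subdivision vertices, and n₂ vertices in each of r copies of G₂
    d₁ : Carrier
    d₁ = ι n₁ - 1# + ι n₂ * ι r

    A₁-row-sum : ∀ v → ∑ (A₁ v) ≈ ι r
    A₁-row-sum v = trans (sym (ι-degree G₁ v)) (reflexive (≡.cong ι (regular v)))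

    B-row-sum : ∀ v → ∑ (B v) ≈ ι r
    B-row-sum v = trans (incidence-row-sum G₁ v) (reflexive (≡.cong ι (regular v)))

    degree-vertex : ∀ v → ι (degree (G₁ ⊡ G₂) (old (vertex v))) ≈ d₁
    degree-vertex v = begin
      ι (degree (G₁ ⊡ G₂) (old (vertex v)))
        ≈⟨ trans (ι-degree (G₁ ⊡ G₂) (old (vertex v))) (∑-vertices _) ⟩
      ∑ (λ u → A (old (vertex v)) (old (vertex u))) + ∑ (λ e → A (old (vertex v)) (old (edge e))) +
        ∑ (λ e → ∑ (λ w → A (old (vertex v)) (copy e w)))
        ≈⟨ +-cong (+-cong (∑-cong λ u → A-vertex-vertex v u) (∑-cong λ e → reflexive (A-vertex-edge v e)))
                  (∑-cong λ e → trans (∑-cong λ w → reflexive (A-vertex-copy v e w)) (∑-const n₂ _)) ⟩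
      ∑ (λ u → 1# - identity v u - A₁ v u) + ∑ (B v) + ∑ (λ e → ι n₂ * B v e)
        ≈⟨ +-cong (+-cong non-neighbours (B-row-sum v)) (trans (∑-*ˡ _ _) (*-congˡ (B-row-sum v))) ⟩
      (ι n₁ - 1# - ι r) + ι r + ι n₂ * ι r
        ≈⟨ solve 3 (λ n r s → (n :- :1 :- r) :+ r :+ s := n :- :1 :+ s) refl (ι n₁) (ι r) (ι n₂ * ι r) ⟩
      d₁ ∎
      where
      non-neighbours : ∑ (λ u → 1# - identity v u - A₁ v u) ≈ ι n₁ - 1# - ι r
      non-neighbours = begin
        ∑ (λ u → 1# - identity v u - A₁ v u)
          ≈⟨ trans (∑-+ _ _) (+-cong (∑-+ _ _) (∑-neg _)) ⟩
        ∑ {n₁} (λ u → 1#) + ∑ (λ u → - identity v u) - ∑ (A₁ v)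
          ≈⟨ +-cong (+-cong (∑-1 n₁) (trans (∑-neg _) (-‿cong (trans (∑-cong λ u → sym (*-identityʳ _)) (∑-identity v _)))))
                    (-‿cong (A₁-row-sum v)) ⟩
        ι n₁ - 1# - ι r ∎

    degree-edge : ∀ e → ι (degree (G₁ ⊡ G₂) (old (edge e))) ≈ ι 2
    degree-edge e = begin
      ι (degree (G₁ ⊡ G₂) (old (edge e)))
        ≈⟨ trans (ι-degree (G₁ ⊡ G₂) (old (edge e))) (∑-vertices _) ⟩
      ∑ (λ v → A (old (edge e)) (old (vertex v))) + ∑ (λ e′ → A (old (edge e)) (old (edge e′))) +
        ∑ (λ e′ → ∑ (λ w → A (old (edge e)) (copy e′ w)))
        ≈⟨ +-cong (+-cong (trans (∑-cong λ v → reflexive (A-edge-vertex e v)) (incidence-column-sum G₁ e))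
                          (∑-zero λ e′ → reflexive (A-edge-edge e e′)))
                  (∑-zero λ e′ → ∑-zero λ w → reflexive (A-edge-copy e e′ w)) ⟩
      ι 2 + 0# + 0#
        ≈⟨ trans (+-identityʳ _) (+-identityʳ _) ⟩
      ι 2 ∎

    degree-copy : ∀ e w → ι (degree (G₁ ⊡ G₂) (copy e w)) ≈ ι 2 + ι (degree G₂ w)
    degree-copy e w = begin
      ι (degree (G₁ ⊡ G₂) (copy e w))
        ≈⟨ trans (ι-degree (G₁ ⊡ G₂) (copy e w)) (∑-vertices _) ⟩
      ∑ (λ v → A (copy e w) (old (vertex v))) + ∑ (λ e′ → A (copy e w) (old (edge e′))) +
        ∑ (λ e′ → ∑ (λ w′ → A (copy e w) (copy e′ w′)))
        ≈⟨ +-cong (+-cong (trans (∑-cong λ v → reflexive (A-copy-vertex e w v)) (incidence-column-sum G₁ e))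
                          (∑-zero λ e′ → reflexive (A-copy-edge e w e′)))
                  (∑-cong λ e′ → trans (∑-cong λ w′ → A-copy-copy e w e′ w′) (∑-*ˡ _ _)) ⟩
      ι 2 + 0# + ∑ (λ e′ → identity e e′ * ∑ (A₂ w))
        ≈⟨ +-cong (+-identityʳ _) (trans (∑-identity e _) (sym (ι-degree G₂ w))) ⟩
      ι 2 + ι (degree G₂ w) ∎

    -- The blocks of x I − L

    -- x I − L
    M : Matrix N
    M i j = x * identity i j - laplacian (G₁ ⊡ G₂) i j

    M-entry : ∀ {i j d δ a} → ι (degree (G₁ ⊡ G₂) i) ≈ d → identity i j ≡ δ → A i j ≈ a →
              M i j ≈ (x - d) * δ + a
    M-entry {i} {j} {d} {δ} {a} deg id adj = begin
      x * identity i j - (ι (degree (G₁ ⊡ G₂) i) * identity i j - A i j)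
        ≈⟨ +-cong (*-congˡ (reflexive id)) (-‿cong (+-cong (*-cong deg (reflexive id)) (-‿cong adj))) ⟩
      x * δ - (d * δ - a)
        ≈⟨ solve 4 (λ x d δ a → x :* δ :- (d :* δ :- a) := (x :- d) :* δ :+ a) refl x d δ a ⟩
      (x - d) * δ + a ∎

    M-entry-0 : ∀ {i j a} → i ≢ j → A i j ≈ a → M i j ≈ a
    M-entry-0 i≢j adj = trans (M-entry refl (identity-≢ i≢j) adj)
      (trans (+-congʳ (zeroʳ _)) (+-identityˡ _))

    identity-old : ∀ i j → identity (old i) (old j) ≡ identity i j
    identity-old = identity-injective (↑ˡ-injective _ _ _)

    identity-copy : ∀ e w e′ w′ → identity (copy e w) (copy e′ w′) ≈ identity e e′ * identity w w′
    identity-copy e w e′ w′ with e ≟ e′ | w ≟ w′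
    ... | yes ≡.refl | yes ≡.refl = trans (reflexive (identity-≡ (copy e w))) (sym (*-identityˡ _))
    ... | yes ≡.refl | no w≢w′ = trans (reflexive (identity-≢ (w≢w′ ∘ proj₂ ∘ combine-injective e w e w′ ∘ ↑ʳ-injective k _ _)))
                                       (sym (*-identityˡ _))
    ... | no e≢e′ | _ = trans (reflexive (identity-≢ (e≢e′ ∘ proj₁ ∘ combine-injective e w e′ w′ ∘ ↑ʳ-injective k _ _)))
                              (sym (zeroˡ _))

    -- y I − L(G₂)
    P : Matrix n₂
    P w w′ = y * identity w w′ - laplacian G₂ w w′

    M-vertex-vertex : ∀ u v → M (old (vertex u)) (old (vertex v)) ≈
                              (x - d₁) * identity u v + (1# - identity u v - A₁ u v)
    M-vertex-vertex u v = M-entry (degree-vertex u)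
      (≡.trans (identity-old (vertex u) (vertex v)) (identity-injective (↑ˡ-injective m₁ _ _) u v)) (A-vertex-vertex u v)

    M-vertex-edge : ∀ v e → M (old (vertex v)) (old (edge e)) ≈ B v e
    M-vertex-edge v e = M-entry-0 (↑ˡ≢↑ʳ v e ∘ ↑ˡ-injective _ _ _) (reflexive (A-vertex-edge v e))

    M-edge-vertex : ∀ e v → M (old (edge e)) (old (vertex v)) ≈ B v e
    M-edge-vertex e v = M-entry-0 (↑ˡ≢↑ʳ v e ∘ ≡.sym ∘ ↑ˡ-injective _ _ _) (reflexive (A-edge-vertex e v))

    M-edge-edge : ∀ e e′ → M (old (edge e)) (old (edge e′)) ≈ y * identity e e′
    M-edge-edge e e′ = trans (M-entry (degree-edge e)
      (≡.trans (identity-old (edge e) (edge e′)) (identity-injective (↑ʳ-injective n₁ _ _) e e′)) (reflexive (A-edge-edge e e′))) (+-identityʳ _)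

    M-vertex-copy : ∀ v e w → M (old (vertex v)) (copy e w) ≈ B v e
    M-vertex-copy v e w = M-entry-0 (↑ˡ≢↑ʳ (vertex v) (combine {m₁} e w)) (reflexive (A-vertex-copy v e w))

    M-edge-copy : ∀ e e′ w → M (old (edge e)) (copy e′ w) ≈ 0#
    M-edge-copy e e′ w = M-entry-0 (↑ˡ≢↑ʳ (edge e) (combine {m₁} e′ w)) (reflexive (A-edge-copy e e′ w))

    M-copy-vertex : ∀ e w v → M (copy e w) (old (vertex v)) ≈ B v e
    M-copy-vertex e w v = M-entry-0 (↑ˡ≢↑ʳ (vertex v) (combine {m₁} e w) ∘ ≡.sym) (reflexive (A-copy-vertex e w v))

    M-copy-edge : ∀ e w e′ → M (copy e w) (old (edge e′)) ≈ 0#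
    M-copy-edge e w e′ = M-entry-0 (↑ˡ≢↑ʳ (edge e′) (combine {m₁} e w) ∘ ≡.sym) (reflexive (A-copy-edge e w e′))

    M-copy-copy : ∀ e w e′ w′ → M (copy e w) (copy e′ w′) ≈ identity e e′ * P w w′
    M-copy-copy e w e′ w′ = begin
      M (copy e w) (copy e′ w′)
        ≈⟨ M-entry (degree-copy e w) ≡.refl (A-copy-copy e w e′ w′) ⟩
      (x - (ι 2 + ι (degree G₂ w))) * identity (copy e w) (copy e′ w′) + identity e e′ * A₂ w w′
        ≈⟨ +-congʳ (*-congˡ (identity-copy e w e′ w′)) ⟩
      (x - (ι 2 + ι (degree G₂ w))) * (identity e e′ * identity w w′) + identity e e′ * A₂ w w′
        ≈⟨ solve 6 (λ x t d δ ε a → (x :- (t :+ d)) :* (δ :* ε) :+ δ :* a := δ :* ((x :- t) :* ε :- (d :* ε :- a)))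
             refl x (ι 2) (ι (degree G₂ w)) (identity e e′) (identity w w′) (A₂ w w′) ⟩
      identity e e′ * P w w′ ∎

    P-column-sum : ∀ w → ∑ (λ w′ → P w′ w) ≈ y
    P-column-sum w = begin
      ∑ (λ w′ → y * identity w′ w - laplacian G₂ w′ w)
        ≈⟨ trans (∑-+ _ _) (+-cong (∑-*ˡ _ _) (∑-neg _)) ⟩
      y * ∑ (λ w′ → identity w′ w) - ∑ (λ w′ → laplacian G₂ w′ w)
        ≈⟨ +-cong (*-congˡ (trans (∑-cong λ w′ → trans (reflexive (identity-sym w′ w)) (sym (*-identityʳ _))) (∑-identity w _)))
                  (-‿cong (laplacian-column-sum G₂ w)) ⟩
      y * 1# - 0#
        ≈⟨ solve 1 (λ y → y :* :1 :- :0 := y) refl y ⟩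
      y ∎

    -- Elimination of the copies of G₂

    -- The rows of the vertices of G₁ are multiplied by y, those of the subdivision
    -- vertices are kept.  From the row of v the rows of all vertices in the copies
    -- that belong to the edges at v are subtracted.

    scale : Fin k → Carrier
    scale i = [ (λ _ → y) , (λ _ → 1#) ]′ (splitAt n₁ i)

    weight : Fin k → Fin (m₁ ℕ.* n₂) → Carrier
    weight i t = [ (λ v → B v (quotient {m₁} n₂ t)) , (λ _ → 0#) ]′ (splitAt n₁ i)

    scale-vertex : ∀ v → scale (vertex v) ≡ y
    scale-vertex v = ≡.cong [ _ , _ ]′ (splitAt-↑ˡ n₁ v m₁)

    scale-edge : ∀ e → scale (edge e) ≡ 1#
    scale-edge e = ≡.cong [ _ , _ ]′ (splitAt-↑ʳ n₁ m₁ e)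

    weight-vertex : ∀ v e w → weight (vertex v) (combine {m₁} e w) ≡ B v e
    weight-vertex v e w = ≡.trans (≡.cong [ _ , _ ]′ (splitAt-↑ˡ n₁ v m₁)) (≡.cong (B v ∘ proj₁) (remQuot-combine {m₁} e w))

    weight-edge : ∀ e t → weight (edge e) t ≡ 0#
    weight-edge e t = ≡.cong [ _ , _ ]′ (splitAt-↑ʳ n₁ m₁ e)

    combine-elim : ∀ {p} {Q : Fin (m₁ ℕ.* n₂) → Set p} → (∀ e w → Q (combine {m₁} e w)) → ∀ t → Q t
    combine-elim {Q = Q} q t = ≡.subst Q (combine-remQuot {m₁} n₂ t) (q _ _)

    weighted-copies : ∀ v j → ∑ (λ t → weight (vertex v) t * M (k ↑ʳ t) j) ≈
                              ∑ (λ e → B v e * ∑ (λ w → M (copy e w) j))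
    weighted-copies v j = trans (∑-combine m₁ _) (∑-cong λ e →
      trans (∑-cong λ w → *-congʳ (reflexive (weight-vertex v e w))) (∑-*ˡ _ _))

    no-weight : ∀ e j → ∑ (λ t → weight (edge e) t * M (k ↑ʳ t) j) ≈ 0#
    no-weight e j = ∑-zero λ t → trans (*-congʳ (reflexive (weight-edge e t))) (zeroˡ _)

    -- This is where 1ᵀ P = y 1ᵀ enters.

    copies-eliminated : ∀ i t → scale i * M (old i) (k ↑ʳ t) ≈ ∑ (λ s → weight i s * M (k ↑ʳ s) (k ↑ʳ t))
    copies-eliminated = ↑-elim n₁
      (λ v → combine-elim λ e w → begin
        scale (vertex v) * M (old (vertex v)) (copy e w)
          ≈⟨ *-cong (reflexive (scale-vertex v)) (M-vertex-copy v e w) ⟩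
        y * B v e
          ≈⟨ *-comm _ _ ⟩
        B v e * y
          ≈⟨ *-congˡ (P-column-sum w) ⟨
        B v e * ∑ (λ w′ → P w′ w)
          ≈⟨ ∑-identity e _ ⟨
        ∑ (λ e′ → identity e e′ * (B v e′ * ∑ (λ w′ → P w′ w)))
          ≈⟨ ∑-cong (λ e′ → solve 3 (λ a b c → a :* (b :* c) := b :* (a :* c)) refl (identity e e′) (B v e′) (∑ (λ w′ → P w′ w))) ⟩
        ∑ (λ e′ → B v e′ * (identity e e′ * ∑ (λ w′ → P w′ w)))
          ≈⟨ ∑-cong (λ e′ → *-congˡ (trans (*-congʳ (reflexive (identity-sym e e′))) (trans (sym (∑-*ˡ _ _))
               (∑-cong λ w′ → sym (M-copy-copy e′ w′ e w))))) ⟩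
        ∑ (λ e′ → B v e′ * ∑ (λ w′ → M (copy e′ w′) (copy e w)))
          ≈⟨ weighted-copies v (copy e w) ⟨
        ∑ (λ s → weight (vertex v) s * M (k ↑ʳ s) (copy e w)) ∎)
      (λ e → combine-elim λ e′ w → trans
        (trans (*-congˡ (M-edge-copy e e′ w)) (zeroʳ _))
        (sym (no-weight e (copy e′ w))))

    -- the block that remains for the central graph
    T : Matrix k
    T i j = scale i * M (old i) (old j) - ∑ (λ t → weight i t * M (k ↑ʳ t) (old j))

    eliminate-copies : y ^ n₁ * Det M ≈ Det T * Det P ^ m₁
    eliminate-copies = begin
      y ^ n₁ * Det M
        ≈⟨ *-congʳ product-scale ⟨
      product scale * Det M
        ≈⟨ det-eliminate k M scale weight copies-eliminated ⟩
      Det T * Det (λ i j → M (k ↑ʳ i) (k ↑ʳ j))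
        ≈⟨ *-congˡ (det-block-diagonal m₁ P (λ i j → M (k ↑ʳ i) (k ↑ʳ j)) M-copy-copy) ⟩
      Det T * Det P ^ m₁ ∎
      where
      product-scale : product scale ≈ y ^ n₁
      product-scale = begin
        product scale
          ≈⟨ product-↑ n₁ scale ⟩
        product (λ v → scale (vertex v)) * product (λ e → scale (edge e))
          ≈⟨ *-cong (trans (product-cong (reflexive ∘ scale-vertex)) (product-replicate n₁ y)) (product-one (reflexive ∘ scale-edge)) ⟩
        y ^ n₁ * 1#
          ≈⟨ *-identityʳ _ ⟩
        y ^ n₁ ∎

    -- Elimination of the subdivision vertices

    B-gram : ∀ u v → ∑ (λ e → B u e * B v e) ≈ ι r * identity u v + A₁ u v
    B-gram u v = trans (incidence-gram G₁ u v) (+-congʳ (*-congʳ (reflexive (≡.cong ι (regular u)))))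

    T-vertex-vertex : ∀ u v → T (vertex u) (vertex v) ≈
      y * ((x - d₁) * identity u v + (1# - identity u v - A₁ u v)) - ι n₂ * (ι r * identity u v + A₁ u v)
    T-vertex-vertex u v = +-cong (*-cong (reflexive (scale-vertex u)) (M-vertex-vertex u v)) (-‿cong (begin
      ∑ (λ t → weight (vertex u) t * M (k ↑ʳ t) (old (vertex v)))
        ≈⟨ weighted-copies u (old (vertex v)) ⟩
      ∑ (λ e → B u e * ∑ (λ w → M (copy e w) (old (vertex v))))
        ≈⟨ ∑-cong (λ e → *-congˡ (trans (∑-cong λ w → M-copy-vertex e w v) (∑-const n₂ _))) ⟩
      ∑ (λ e → B u e * (ι n₂ * B v e))
        ≈⟨ ∑-cong (λ e → solve 3 (λ a b c → a :* (b :* c) := b :* (a :* c)) refl (B u e) (ι n₂) (B v e)) ⟩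
      ∑ (λ e → ι n₂ * (B u e * B v e))
        ≈⟨ trans (∑-*ˡ _ _) (*-congˡ (B-gram u v)) ⟩
      ι n₂ * (ι r * identity u v + A₁ u v) ∎))
    T-vertex-edge : ∀ v e → T (vertex v) (edge e) ≈ y * B v e
    T-vertex-edge v e = begin
      scale (vertex v) * M (old (vertex v)) (old (edge e)) - ∑ (λ t → weight (vertex v) t * M (k ↑ʳ t) (old (edge e)))
        ≈⟨ +-cong (*-cong (reflexive (scale-vertex v)) (M-vertex-edge v e)) (-‿cong (trans (weighted-copies v (old (edge e)))
             (∑-zero λ e′ → trans (*-congˡ (∑-zero λ w → M-copy-edge e′ w e)) (zeroʳ _)))) ⟩
      y * B v e - 0#
        ≈⟨ solve 1 (λ z → z :- :0 := z) refl _ ⟩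
      y * B v e ∎

    T-edge : ∀ e j → T (edge e) j ≈ M (old (edge e)) (old j)
    T-edge e j = begin
      scale (edge e) * M (old (edge e)) (old j) - ∑ (λ t → weight (edge e) t * M (k ↑ʳ t) (old j))
        ≈⟨ +-cong (*-congʳ (reflexive (scale-edge e))) (-‿cong (no-weight e (old j))) ⟩
      1# * M (old (edge e)) (old j) - 0#
        ≈⟨ solve 1 (λ z → :1 :* z :- :0 := z) refl _ ⟩
      M (old (edge e)) (old j) ∎

  -- The diagonal coefficient a and the adjacency coefficient −c of the matrix to
  -- which the elimination reduces x I − L.

  a c : Carrier
  a = y * (x - ι n₁ - ι n₂ * ι r) - (ι n₂ + 1#) * ι r
  c = y + ι n₂ + 1#

  private
    eliminate-edges : Det T ≈ Det (λ u v → a * identity u v + y - c * A₁ u v) * y ^ m₁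
    eliminate-edges = begin
      Det T
        ≈⟨ trans (*-congʳ (product-one {n₁} (λ _ → refl))) (*-identityˡ _) ⟨
      product {n₁} (λ _ → 1#) * Det T
        ≈⟨ det-eliminate n₁ T (λ _ → 1#) B (λ v e → trans (trans (*-identityˡ _) (T-vertex-edge v e)) (sym (edges-eliminated v e))) ⟩
      Det (λ u v → 1# * T (vertex u) (vertex v) - ∑ (λ e → B u e * T (edge e) (vertex v))) *
        Det (λ e e′ → T (edge e) (edge e′))
        ≈⟨ *-cong (det-cong top) (trans (det-cong λ e e′ → trans (T-edge e (edge e′)) (M-edge-edge e e′)) (det-scalar m₁ y)) ⟩
      Det (λ u v → a * identity u v + y - c * A₁ u v) * y ^ m₁ ∎
      where
      edges-eliminated : ∀ v e → ∑ (λ t → B v t * T (edge t) (edge e)) ≈ y * B v e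
      edges-eliminated v e = begin
        ∑ (λ t → B v t * T (edge t) (edge e))
          ≈⟨ ∑-cong (λ t → *-congˡ (trans (T-edge t (edge e)) (M-edge-edge t e))) ⟩
        ∑ (λ t → B v t * (y * identity t e))
          ≈⟨ ∑-cong (λ t → trans (solve 3 (λ a b c → a :* (b :* c) := c :* (b :* a)) refl (B v t) y (identity t e))
                                 (*-congʳ (reflexive (identity-sym t e)))) ⟩
        ∑ (λ t → identity e t * (y * B v t))
          ≈⟨ ∑-identity e _ ⟩
        y * B v e ∎
      top : ∀ u v → 1# * T (vertex u) (vertex v) - ∑ (λ e → B u e * T (edge e) (vertex v)) ≈ a * identity u v + y - c * A₁ u v
      top u v = begin
        1# * T (vertex u) (vertex v) - ∑ (λ e → B u e * T (edge e) (vertex v))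
          ≈⟨ +-cong (*-congˡ (T-vertex-vertex u v)) (-‿cong (trans
               (∑-cong λ e → *-congˡ (trans (T-edge e (vertex v)) (M-edge-vertex e v))) (B-gram u v))) ⟩
        1# * (y * ((x - d₁) * identity u v + (1# - identity u v - A₁ u v)) - ι n₂ * (ι r * identity u v + A₁ u v)) -
          (ι r * identity u v + A₁ u v)
          ≈⟨ solve 7 (λ x y n m r δ α →
               :1 :* (y :* ((x :- (n :- :1 :+ m :* r)) :* δ :+ (:1 :- δ :- α)) :- m :* (r :* δ :+ α)) :- (r :* δ :+ α) :=
               (y :* (x :- n :- m :* r) :- (m :+ :1) :* r) :* δ :+ y :- (y :+ m :+ :1) :* α)
               refl x y (ι n₁) (ι n₂) (ι r) (identity u v) (A₁ u v) ⟩
        a * identity u v + y - c * A₁ u v ∎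

  corona-determinant : y ^ n₁ * Det M ≈ Det (λ u v → a * identity u v + y - c * A₁ u v) * y ^ m₁ * Det P ^ m₁
  corona-determinant = trans eliminate-copies (*-congʳ eliminate-edges)

-- Polynomial functions

module PolynomialFunctions {c ℓ} (R : CommutativeRing c ℓ) where
  open CommutativeRing R hiding (zero)
  open Matrices R
  open IntegerSolver R
  open Determinant R
  open Relation.Binary.Reasoning.Setoid setoid

  -- Some iterated difference of F vanishes.  Polynomials have this property; that
  -- other functions may have it too does no harm.

  data IsPolynomial (F : Carrier → Carrier) : Set (c ⊔ ℓ) where
    vanishing  : (∀ x → F x ≈ 0#) → IsPolynomial F
    difference : IsPolynomial (λ x → F (x + 1#) - F x) → IsPolynomial F

  polynomial-resp : ∀ {F G} → (∀ x → F x ≈ G x) → IsPolynomial F → IsPolynomial G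
  polynomial-resp F≈G (vanishing F≈0) = vanishing λ x → trans (sym (F≈G x)) (F≈0 x)
  polynomial-resp F≈G (difference p)  =
    difference (polynomial-resp (λ x → +-cong (F≈G (x + 1#)) (-‿cong (F≈G x))) p)

  polynomial-const : ∀ a → IsPolynomial (λ _ → a)
  polynomial-const a = difference (vanishing λ _ → -‿inverseʳ a)

  polynomial-id : IsPolynomial (λ x → x)
  polynomial-id = difference (polynomial-resp
    (λ x → solve 1 (λ x → :1 := x :+ :1 :- x) refl x) (polynomial-const 1#))

  polynomial-+ : ∀ {F G} → IsPolynomial F → IsPolynomial G → IsPolynomial (λ x → F x + G x)
  polynomial-+ (vanishing F≈0) q = polynomial-resp (λ x → sym (trans (+-congʳ (F≈0 x)) (+-identityˡ _))) q
  polynomial-+ p@(difference _) (vanishing G≈0) = polynomial-resp (λ x → sym (trans (+-congˡ (G≈0 x)) (+-identityʳ _))) p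
  polynomial-+ {F} {G} (difference p) (difference q) = difference (polynomial-resp
    (λ x → solve 4 (λ a b c d → (a :- b) :+ (c :- d) := (a :+ c) :- (b :+ d)) refl (F (x + 1#)) (F x) (G (x + 1#)) (G x))
    (polynomial-+ p q))

  polynomial-* : ∀ {F G} → IsPolynomial F → IsPolynomial G → IsPolynomial (λ x → F x * G x)
  polynomial-* (vanishing F≈0) q = vanishing λ x → trans (*-congʳ (F≈0 x)) (zeroˡ _)
  polynomial-* (difference _) (vanishing G≈0) = vanishing λ x → trans (*-congˡ (G≈0 x)) (zeroʳ _)
  polynomial-* {F} {G} (difference p) (difference q) = difference (polynomial-resp
    -- Δ(FG) = ΔF G + ΔF ΔG + F ΔG
    (λ x → solve 4 (λ a b c d → (a :- b) :* d :+ (a :- b) :* (c :- d) :+ b :* (c :- d) := a :* c :- b :* d)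
             refl (F (x + 1#)) (F x) (G (x + 1#)) (G x))
    (polynomial-+ (polynomial-+ (polynomial-* p (difference q)) (polynomial-* p q)) (polynomial-* (difference p) q)))

  polynomial-neg : ∀ {F} → IsPolynomial F → IsPolynomial (λ x → - F x)
  polynomial-neg p = polynomial-resp (λ x → solve 1 (λ a → :- :1 :* a := :- a) refl _)
    (polynomial-* (polynomial-const (- 1#)) p)

  polynomial-- : ∀ {F G} → IsPolynomial F → IsPolynomial G → IsPolynomial (λ x → F x - G x)
  polynomial-- p q = polynomial-+ p (polynomial-neg q)

  polynomial-^ : ∀ {F} n → IsPolynomial F → IsPolynomial (λ x → F x ^ n)
  polynomial-^ zero    p = polynomial-const 1#
  polynomial-^ (suc n) p = polynomial-* p (polynomial-^ n p)

  polynomial-∑ : ∀ {n} {F : Carrier → Fin n → Carrier} → (∀ i → IsPolynomial (λ x → F x i)) → IsPolynomial (λ x → ∑ (F x))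
  polynomial-∑ {zero}  p = polynomial-resp (λ x → reflexive (≡.sym (∑-[] _))) (polynomial-const 0#)
  polynomial-∑ {suc n} p = polynomial-resp (λ x → reflexive (≡.sym (∑-suc _)))
    (polynomial-+ (p zero) (polynomial-∑ (p ∘ suc)))

  polynomial-product : ∀ {n} {F : Carrier → Fin n → Carrier} → (∀ i → IsPolynomial (λ x → F x i)) →
                       IsPolynomial (λ x → product (F x))
  polynomial-product {zero}  p = polynomial-const 1#
  polynomial-product {suc n} p = polynomial-* (p zero) (polynomial-product (p ∘ suc))

  polynomial-det : ∀ {n} {M : Carrier → Matrix n} → (∀ i j → IsPolynomial (λ x → M x i j)) →
                   IsPolynomial (λ x → Det (M x))
  polynomial-det {zero}  p = polynomial-resp (λ x → reflexive (≡.sym (Det-[] _))) (polynomial-const 1#)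
  polynomial-det {suc n} p = polynomial-resp (λ x → reflexive (≡.sym (Det-expand _)))
    (polynomial-∑ λ j → polynomial-* (polynomial-* (polynomial-const (sign j)) (p zero j))
                                     (polynomial-det λ i k → p (suc i) (punchIn j k)))

  -- x + k

  shift : ℕ → Carrier → Carrier
  shift zero    x = x
  shift (suc k) x = shift k x + 1#

  polynomial-determined : ∀ {F} → IsPolynomial F → ∀ x → (∀ k → F (shift (suc k) x) ≈ 0#) → F x ≈ 0#
  polynomial-determined (vanishing F≈0) x _ = F≈0 x
  polynomial-determined {F} (difference p) x zeros = begin
    F x                           ≈⟨ solve 2 (λ a b → b := a :- (a :- b)) refl (F (x + 1#)) (F x) ⟩
    F (x + 1#) - (F (x + 1#) - F x)  ≈⟨ +-cong (zeros 0) (-‿cong (polynomial-determined p x λ k →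
                                          trans (+-cong (zeros (suc k)) (-‿cong (zeros k))) (-‿inverseʳ 0#))) ⟩
    0# - 0#                       ≈⟨ -‿inverseʳ 0# ⟩
    0#                            ∎

-- Ordered fields

module OrderedFieldProperties {c ℓ₁ ℓ₂ ℓ₃} (K : OrderedField c ℓ₁ ℓ₂ ℓ₃) where
  open OrderedField K using
    ( _<_; _≤_; _#_; isStrictPartialOrder; <⇒#; #⇒<⊎>; 0<1; +-monoˡ-<; *-pos; tight
    ; #-cotrans; #-sym; #⇒invertible; commutativeRing; heytingCommutativeRing)
  open CommutativeRing commutativeRing hiding (zero)
  open Algebra.Apartness.Properties.HeytingCommutativeRing heytingCommutativeRing using (x-0≈x; invertibleˡ⇒#; #-congʳ)
  open Matrices commutativeRing
  open IntegerSolver commutativeRing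
  open Determinant commutativeRing
  open PolynomialFunctions commutativeRing
  open IsStrictPartialOrder isStrictPartialOrder using (<-respˡ-≈; <-respʳ-≈; irrefl) renaming (trans to <-trans)
  open Relation.Binary.Reasoning.Setoid setoid

  ≈-stable : ∀ {x y} → ¬ (x # y) → x ≈ y
  ≈-stable = proj₁ (tight _ _)

  -- An equation may be proved by cases on whether x is invertible or zero,
  -- although neither need be decidable.

  ≈-by-cases : ∀ {x a b} → (x # 0# → a ≈ b) → (x ≈ 0# → a ≈ b) → a ≈ b
  ≈-by-cases nonzero zero′ = ≈-stable λ a#b →
    proj₂ (tight _ _) (zero′ (≈-stable λ x#0 → proj₂ (tight _ _) (nonzero x#0) a#b)) a#b

  reciprocal : ∀ {x} → x # 0# → ∃[ z ] z * x ≈ 1#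
  reciprocal x#0 = let z , zx≈1 , _ = #⇒invertible x#0 in z , trans (*-congˡ (sym (x-0≈x _))) zx≈1

  *-cancel-0 : ∀ {x y} → x # 0# → x * y ≈ 0# → y ≈ 0#
  *-cancel-0 {x} {y} x#0 xy≈0 = let z , zx≈1 = reciprocal x#0 in begin
    y            ≈⟨ *-identityˡ y ⟨
    1# * y       ≈⟨ *-congʳ zx≈1 ⟨
    z * x * y    ≈⟨ *-assoc _ _ _ ⟩
    z * (x * y)  ≈⟨ *-congˡ xy≈0 ⟩
    z * 0#       ≈⟨ zeroʳ z ⟩
    0#           ∎

  -- The factors of an invertible product are invertible.

  *-#0ˡ : ∀ {x y} → x * y # 0# → x # 0#
  *-#0ˡ {x} {y} xy#0 = let z , zxy≈1 = reciprocal xy#0 in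
    invertibleˡ⇒# (z * y , trans (*-congˡ (x-0≈x x))
      (trans (solve 3 (λ x y z → z :* y :* x := z :* (x :* y)) refl x y z) zxy≈1))

  -- Order

  <-cotrans : ∀ {x y} → x < y → ∀ z → x < z ⊎ z < y
  <-cotrans {x} {y} x<y z with #-cotrans (<⇒# x<y) z
  ... | inj₁ x#z = Sum.map₂ (λ z<x → <-trans z<x x<y) (#⇒<⊎> x#z)
  ... | inj₂ z#y = Sum.swap (Sum.map₂ (<-trans x<y) (#⇒<⊎> z#y))

  ≤-<-trans : ∀ {x y z} → x ≤ y → y < z → x < z
  ≤-<-trans x≤y y<z = Sum.[ ⊥-elim ∘ x≤y , id ] (<-cotrans y<z _)

  0≤-resp : ∀ {x y} → x ≈ y → 0# ≤ x → 0# ≤ y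
  0≤-resp x≈y 0≤x y<0 = 0≤x (<-respˡ-≈ (sym x≈y) y<0)

  +-pos : ∀ {x y} → 0# < x → 0# ≤ y → 0# < x + y
  +-pos {x} {y} 0<x 0≤y = ≤-<-trans 0≤y (<-respˡ-≈ (+-identityˡ y) (+-monoˡ-< y 0<x))

  +-nonneg : ∀ {x y} → 0# ≤ x → 0# ≤ y → 0# ≤ x + y
  +-nonneg {x} {y} 0≤x 0≤y x+y<0 with <-cotrans x+y<0 y
  ... | inj₂ y<0   = 0≤y y<0
  ... | inj₁ x+y<y = 0≤x (<-respˡ-≈ (solve 2 (λ x y → x :+ y :- y := x) refl x y)
                           (<-respʳ-≈ (-‿inverseʳ y) (+-monoˡ-< (- y) x+y<y)))

  neg-pos : ∀ {x} → x < 0# → 0# < - x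
  neg-pos {x} x<0 = <-respˡ-≈ (-‿inverseʳ x) (<-respʳ-≈ (+-identityˡ (- x)) (+-monoˡ-< (- x) x<0))

  <⇒0<- : ∀ {x y} → x < y → 0# < y - x
  <⇒0<- {x} x<y = <-respˡ-≈ (-‿inverseʳ x) (+-monoˡ-< (- x) x<y)

  *-nonneg : ∀ {x y} → 0# ≤ x → 0# ≤ y → 0# ≤ x * y
  *-nonneg {x} {y} 0≤x 0≤y xy<0 = Sum.[ 0≤x , 0≮x ] (#⇒<⊎> x#0)
    where
    xy#0 : x * y # 0#
    xy#0 = <⇒# xy<0
    x#0 : x # 0#
    x#0 = *-#0ˡ {x} {y} xy#0
    y#0 : y # 0#
    y#0 = *-#0ˡ {y} {x} (#-congʳ (*-comm x y) xy#0)
    0≮x : ¬ (0# < x)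
    0≮x 0<x = Sum.[ 0≤y , (λ 0<y → irrefl refl (<-trans xy<0 (*-pos 0<x 0<y))) ] (#⇒<⊎> y#0)

  <⇒≤ : ∀ {x y} → x < y → x ≤ y
  <⇒≤ x<y y<x = irrefl refl (<-trans x<y y<x)

  0≤0 : 0# ≤ 0#
  0≤0 = irrefl refl

  reciprocal-pos : ∀ {x z} → 0# < x → z * x ≈ 1# → 0# < z
  reciprocal-pos {x} {z} 0<x zx≈1 = Sum.[ (λ z<0 → ⊥-elim (z≮0 z<0)) , id ]′ (#⇒<⊎> z#0)
    where
    z#0 : z # 0#
    z#0 = *-#0ˡ {z} {x} (#-congʳ (sym zx≈1) (#-sym (<⇒# 0<1)))
    z≮0 : ¬ (z < 0#)
    z≮0 z<0 = irrefl (sym (begin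
      - z * x + 1#     ≈⟨ +-congˡ (sym zx≈1) ⟩
      - z * x + z * x  ≈⟨ solve 2 (λ z x → :- z :* x :+ z :* x := :0) refl z x ⟩
      0#               ∎)) (+-pos (*-pos (neg-pos z<0) 0<x) (<⇒≤ 0<1))

  ∑-nonneg : ∀ {n} {f : Fin n → Carrier} → (∀ i → 0# ≤ f i) → 0# ≤ ∑ f
  ∑-nonneg {zero}  0≤f = 0≤-resp (reflexive (≡.sym (∑-[] _))) 0≤0
  ∑-nonneg {suc n} 0≤f = 0≤-resp (reflexive (≡.sym (∑-suc _))) (+-nonneg (0≤f zero) (∑-nonneg (0≤f ∘ suc)))

  product-pos : ∀ {n} {f : Fin n → Carrier} → (∀ i → 0# < f i) → 0# < product f
  product-pos {zero}  0<f = 0<1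
  product-pos {suc n} 0<f = *-pos (0<f zero) (product-pos (0<f ∘ suc))

  -- Cancellation of the factor t − a from an identity of polynomial functions

  cancel-linear : ∀ {F} a → IsPolynomial F → (∀ t → (t - a) * F t ≈ 0#) → ∀ t → F t ≈ 0#
  cancel-linear a p [t-a]F≈0 t = ≈-by-cases {t - a}
    (λ t-a#0 → *-cancel-0 t-a#0 ([t-a]F≈0 t))
    (λ t-a≈0 → polynomial-determined p t λ k → *-cancel-0 (#-sym (<⇒# (shift-pos t-a≈0 k))) ([t-a]F≈0 _))
    where
    move : ∀ t → (t - a) + 1# ≈ (t + 1#) - a
    move t = solve 2 (λ t a → t :- a :+ :1 := t :+ :1 :- a) refl t a
    shift-pos : t - a ≈ 0# → ∀ k → 0# < shift (suc k) t - a
    shift-pos t-a≈0 zero    = <-respʳ-≈ (trans (trans (sym (+-identityˡ 1#)) (+-congʳ (sym t-a≈0))) (move t)) 0<1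
    shift-pos t-a≈0 (suc k) = <-respʳ-≈ (move _) (+-pos (shift-pos t-a≈0 k) (<⇒≤ 0<1))

  cancel-linear-^ : ∀ {F} a n → IsPolynomial F → (∀ t → (t - a) ^ n * F t ≈ 0#) → ∀ t → F t ≈ 0#
  cancel-linear-^ a zero    p h t = trans (sym (*-identityˡ _)) (h t)
  cancel-linear-^ a (suc n) p h   = cancel-linear-^ a n p (cancel-linear a
    (polynomial-* (polynomial-^ n (polynomial-- polynomial-id (polynomial-const a))) p)
    (λ t → trans (sym (*-assoc _ _ _)) (h t)))

  -- A matrix with nonpositive off-diagonal entries and positive row sums has a
  -- positive determinant: the Schur complement S of the top left entry is again
  -- of this kind.

  det-M-matrix-pos : ∀ {n} (M : Matrix n) → (∀ i j → i ≢ j → 0# ≤ - M i j) → (∀ i → 0# < ∑ (M i)) → 0# < Det M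
  det-M-matrix-pos {zero}  M _ _ = <-respʳ-≈ (reflexive (≡.sym (Det-[] M))) 0<1
  det-M-matrix-pos {suc n} M off-diagonal row-sums =
    <-respʳ-≈ (sym det-M) (*-pos 0<M₀₀ (det-M-matrix-pos S S-off-diagonal S-row-sums))
    where
    0<M₀₀ : 0# < M zero zero
    0<M₀₀ = <-respʳ-≈ (begin
      ∑ (M zero) + ∑ (λ j → - M zero (suc j))
        ≈⟨ +-cong (reflexive (∑-suc _)) (∑-neg _) ⟩
      M zero zero + ∑ (λ j → M zero (suc j)) - ∑ (λ j → M zero (suc j))
        ≈⟨ solve 2 (λ a b → a :+ b :- b := a) refl _ _ ⟩
      M zero zero ∎) (+-pos (row-sums zero) (∑-nonneg λ j → off-diagonal zero (suc j) λ ()))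

    z : Carrier
    z = proj₁ (reciprocal (#-sym (<⇒# 0<M₀₀)))

    zM₀₀≈1 : z * M zero zero ≈ 1#
    zM₀₀≈1 = proj₂ (reciprocal (#-sym (<⇒# 0<M₀₀)))

    0<z : 0# < z
    0<z = reciprocal-pos 0<M₀₀ zM₀₀≈1

    -- row suc i of M plus a multiple of row zero, chosen to clear the first column

    cleared : Fin n → Fin (suc n) → Carrier
    cleared i j = M (suc i) j + (- M (suc i) zero * z) * M zero j

    S : Matrix n
    S i j = cleared i (suc j)

    det-M : Det M ≈ M zero zero * Det S
    det-M = begin
      Det M
        ≈⟨ det-cong (λ { zero j → refl ; (suc i) j → refl }) ⟩
      Det (M zero ∷ tail M)
        ≈⟨ det-add-first-row (M zero) (λ i → - M (suc i) zero * z) (tail M) ⟨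
      Det (M zero ∷ cleared)
        ≈⟨ det-first-column (M zero ∷ cleared) (λ i → begin
             M (suc i) zero + (- M (suc i) zero * z) * M zero zero
               ≈⟨ solve 3 (λ m z a → m :+ (:- m :* z) :* a := m :- m :* (z :* a)) refl (M (suc i) zero) z (M zero zero) ⟩
             M (suc i) zero - M (suc i) zero * (z * M zero zero)
               ≈⟨ +-congˡ (-‿cong (*-congˡ zM₀₀≈1)) ⟩
             M (suc i) zero - M (suc i) zero * 1#
               ≈⟨ solve 1 (λ m → m :- m :* :1 := :0) refl _ ⟩
             0# ∎) ⟩
      M zero zero * Det S ∎

    S-off-diagonal : ∀ i j → i ≢ j → 0# ≤ - S i j
    S-off-diagonal i j i≢j = 0≤-resp
      (solve 4 (λ m a z b → :- m :+ :- a :* z :* :- b := :- (m :+ (:- a :* z) :* b))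
         refl (M (suc i) (suc j)) (M (suc i) zero) z (M zero (suc j)))
      (+-nonneg (off-diagonal (suc i) (suc j) (i≢j ∘ Fin.suc-injective))
        (*-nonneg (*-nonneg (off-diagonal (suc i) zero λ ()) (<⇒≤ 0<z)) (off-diagonal zero (suc j) λ ())))

    S-row-sums : ∀ i → 0# < ∑ (S i)
    S-row-sums i = <-respʳ-≈ (sym (begin
      ∑ (λ j → M (suc i) (suc j) + (- M (suc i) zero * z) * M zero (suc j))
        ≈⟨ trans (∑-+ _ _) (+-congˡ (∑-*ˡ _ _)) ⟩
      ∑ (λ j → M (suc i) (suc j)) + (- M (suc i) zero * z) * ∑ (λ j → M zero (suc j))
        ≈⟨ solve 5 (λ s m z a t → s :+ (:- m :* z) :* t := (m :+ s) :+ (:- m) :* (z :* (a :+ t)) :+ m :* (z :* a :- :1))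
             refl _ (M (suc i) zero) z (M zero zero) _ ⟩
      (M (suc i) zero + ∑ (λ j → M (suc i) (suc j))) + - M (suc i) zero * (z * (M zero zero + ∑ (λ j → M zero (suc j)))) +
        M (suc i) zero * (z * M zero zero - 1#)
        ≈⟨ +-cong (+-cong (reflexive (≡.sym (∑-suc _))) (*-congˡ (*-congˡ (reflexive (≡.sym (∑-suc _))))))
                  (*-congˡ (trans (+-congʳ zM₀₀≈1) (-‿inverseʳ 1#))) ⟩
      ∑ (M (suc i)) + - M (suc i) zero * (z * ∑ (M zero)) + M (suc i) zero * 0#
        ≈⟨ trans (+-congˡ (zeroʳ _)) (+-identityʳ _) ⟩
      ∑ (M (suc i)) + - M (suc i) zero * (z * ∑ (M zero)) ∎))
      (+-pos (row-sums (suc i)) (*-nonneg (off-diagonal (suc i) zero λ ()) (<⇒≤ (*-pos 0<z (row-sums zero)))))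

  -- The spectrum of a matrix with constant row and column sums

  module ConstantSums {n} (A : Matrix (suc n)) (r : Carrier)
    (row-sums : ∀ i → ∑ (A i) ≈ r) (column-sums : ∀ j → ∑ (λ i → A i j) ≈ r)
    (ev : Fin (suc n) → Carrier) (spectrum : ∀ x → Det (λ i j → x * identity i j - A i j) ≈ product (λ i → x - ev i))
    where

    row-sum-pencil : ∀ a c i → ∑ (λ j → a * identity i j - c * A i j) ≈ a - c * r
    row-sum-pencil a c i = begin
      ∑ (λ j → a * identity i j - c * A i j)
        ≈⟨ trans (∑-+ _ _) (+-cong (∑-cong λ j → *-comm _ _) (∑-neg _)) ⟩
      ∑ (λ j → identity i j * a) - ∑ (λ j → c * A i j)
        ≈⟨ +-cong (∑-identity i _) (-‿cong (trans (∑-*ˡ _ _) (*-congˡ (row-sums i)))) ⟩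
      a - c * r ∎

    column-sum-pencil : ∀ a c j → ∑ (λ i → a * identity i j - c * A i j) ≈ a - c * r
    column-sum-pencil a c j = begin
      ∑ (λ i → a * identity i j - c * A i j)
        ≈⟨ trans (∑-+ _ _) (+-cong (∑-cong λ i → trans (*-comm _ _) (*-congʳ (reflexive (identity-sym i j)))) (∑-neg _)) ⟩
      ∑ (λ i → identity j i * a) - ∑ (λ i → c * A i j)
        ≈⟨ +-cong (∑-identity j _) (-‿cong (trans (∑-*ˡ _ _) (*-congˡ (column-sums j)))) ⟩
      a - c * r ∎

    -- a I − c A, and its determinant after the first row is replaced by ones

    pencil : Carrier → Carrier → Matrix (suc n)
    pencil a c i j = a * identity i j - c * A i j

    reduced : Carrier → Carrier → Carrier
    reduced a c = Det ((λ _ → 1#) ∷ tail (pencil a c))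

    det-shifted-pencil : ∀ a b c → Det (λ i j → pencil a c i j + b) ≈ (a - c * r + ι (suc n) * b) * reduced a c
    det-shifted-pencil a b c = det-constant-column-sums (pencil a c) (a - c * r) b (column-sum-pencil a c)

    det-pencil : ∀ a c → Det (pencil a c) ≈ (a - c * r) * reduced a c
    det-pencil a c = begin
      Det (pencil a c)
        ≈⟨ det-cong (λ i j → sym (+-identityʳ _)) ⟩
      Det (λ i j → pencil a c i j + 0#)
        ≈⟨ det-shifted-pencil a 0# c ⟩
      (a - c * r + ι (suc n) * 0#) * reduced a c
        ≈⟨ *-congʳ (trans (+-congˡ (zeroʳ _)) (+-identityʳ _)) ⟩
      (a - c * r) * reduced a c ∎

    -- For invertible c this is the spectrum hypothesis at a / c; for c = 0 both
    -- sides are powers of a.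

    det-pencil-spectrum : ∀ a c → Det (pencil a c) ≈ product (λ i → a - c * ev i)
    det-pencil-spectrum a c = ≈-by-cases {c} nonzero zero′
      where
      nonzero : c # 0# → Det (pencil a c) ≈ product (λ i → a - c * ev i)
      nonzero c#0 = begin
        Det (pencil a c)
          ≈⟨ det-cong (λ i j → sym (trans
               (solve 5 (λ c z a d e → c :* ((z :* a) :* d :- e) := (z :* c :* a) :* d :- c :* e) refl c z a (identity i j) (A i j))
               (+-congʳ (*-congʳ zca≈a)))) ⟩
        Det (λ i j → c * ((z * a) * identity i j - A i j))
          ≈⟨ det-rows-* (λ _ → c) _ ⟩
        product {suc n} (λ _ → c) * Det (λ i j → (z * a) * identity i j - A i j)
          ≈⟨ *-congˡ (spectrum (z * a)) ⟩
        product {suc n} (λ _ → c) * product (λ i → z * a - ev i)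
          ≈⟨ product-* {suc n} (λ _ → c) (λ i → z * a - ev i) ⟨
        product (λ i → c * (z * a - ev i))
          ≈⟨ product-cong {suc n} (λ i → trans (solve 4 (λ c z a e → c :* (z :* a :- e) := (z :* c) :* a :- c :* e) refl c z a (ev i))
                                       (+-congʳ zca≈a)) ⟩
        product (λ i → a - c * ev i) ∎
        where
        z : Carrier
        z = proj₁ (reciprocal c#0)
        zca≈a : z * c * a ≈ a
        zca≈a = trans (*-congʳ (proj₂ (reciprocal c#0))) (*-identityˡ a)
      zero′ : c ≈ 0# → Det (pencil a c) ≈ product (λ i → a - c * ev i)
      zero′ c≈0 = begin
        Det (pencil a c)
          ≈⟨ det-cong (λ i j → c-vanishes (A i j) (a * identity i j)) ⟩
        Det (λ i j → a * identity {suc n} i j)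
          ≈⟨ det-scalar (suc n) a ⟩
        a ^ suc n
          ≈⟨ product-replicate (suc n) a ⟨
        product {suc n} (λ _ → a)
          ≈⟨ product-cong {suc n} (λ i → c-vanishes (ev i) a) ⟨
        product (λ i → a - c * ev i) ∎
        where
        c-vanishes : ∀ e a → a - c * e ≈ a
        c-vanishes e a = trans (+-congˡ (-‿cong (trans (*-congʳ c≈0) (zeroˡ e)))) (solve 1 (λ a → a :- :0 := a) refl a)

    module _ (nonneg : ∀ i j → 0# ≤ A i j) (sorted : ∀ i j → i Fin.≤ j → ev j ≤ ev i) where

      -- If ev zero < r then all r − ev i are positive, but det (r I − A) = 0.  If
      -- r < ev zero then det (ev zero I − A) is positive, but ev zero is a root.

      largest-eigenvalue : ev zero ≈ r
      largest-eigenvalue = ≈-stable λ ev₀#r → Sum.[ too-small , too-large ] (#⇒<⊎> ev₀#r)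
        where
        too-small : ev zero < r → ⊥
        too-small ev₀<r = irrefl (begin
          0#                          ≈⟨ zeroˡ _ ⟨
          0# * reduced r 1#           ≈⟨ *-congʳ (solve 1 (λ r → :0 := r :- :1 :* r) refl r) ⟩
          (r - 1# * r) * reduced r 1# ≈⟨ det-pencil r 1# ⟨
          Det (pencil r 1#)           ≈⟨ det-cong (λ i j → +-congˡ (-‿cong (*-identityˡ _))) ⟩
          Det _                       ≈⟨ spectrum r ⟩
          product (λ i → r - ev i)    ∎)
          (product-pos {suc n} {λ i → r - ev i} λ i → <⇒0<- (≤-<-trans (sorted zero i z≤n) ev₀<r))
        too-large : r < ev zero → ⊥
        too-large r<ev₀ = irrefl (sym (begin
          Det (λ i j → ev zero * identity i j - A i j)   ≈⟨ spectrum (ev zero) ⟩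
          product (λ i → ev zero - ev i)                 ≈⟨ *-congʳ (-‿inverseʳ _) ⟩
          0# * _                                         ≈⟨ zeroˡ _ ⟩
          0#                                             ∎))
          (det-M-matrix-pos (λ i j → ev zero * identity i j - A i j)
            (λ i j i≢j → 0≤-resp (begin
              A i j
                ≈⟨ solve 2 (λ e a → a := :- (e :* :0 :- a)) refl (ev zero) (A i j) ⟩
              - (ev zero * 0# - A i j)
                ≈⟨ -‿cong (+-congʳ (*-congˡ (reflexive (≡.sym (identity-≢ i≢j))))) ⟩
              - (ev zero * identity i j - A i j) ∎) (nonneg i j))
            (λ i → <-respʳ-≈ (begin
              ev zero - r
                ≈⟨ +-congˡ (-‿cong (sym (*-identityˡ r))) ⟩
              ev zero - 1# * r
                ≈⟨ row-sum-pencil (ev zero) 1# i ⟨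
              ∑ (λ j → ev zero * identity i j - 1# * A i j)
                ≈⟨ ∑-cong (λ j → +-congˡ (-‿cong (*-identityˡ _))) ⟩
              ∑ (λ j → ev zero * identity i j - A i j) ∎) (<⇒0<- r<ev₀)))

      reduced-spectrum : ∀ a c → reduced a c ≈ product (λ i → a - c * ev (suc i))
      reduced-spectrum a c = begin
        reduced a c
          ≈⟨ solve 2 (λ p q → p := p :- q :+ q) refl _ _ ⟩
        reduced a c - others a + others a
          ≈⟨ +-congʳ (cancel-linear (c * r) polynomial multiple≈0 a) ⟩
        0# + others a
          ≈⟨ +-identityˡ _ ⟩
        others a ∎
        where
        others : Carrier → Carrier
        others a = product (λ i → a - c * ev (suc i))
        polynomial : IsPolynomial (λ a → reduced a c - others a)
        polynomial = polynomial--
          (polynomial-det λ { zero j → polynomial-const 1#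
                            ; (suc i) j → polynomial-- (polynomial-* polynomial-id (polynomial-const _)) (polynomial-const _) })
          (polynomial-product {F = λ a i → a - c * ev (suc i)} λ i → polynomial-- polynomial-id (polynomial-const _))
        multiple≈0 : ∀ a → (a - c * r) * (reduced a c - others a) ≈ 0#
        multiple≈0 a = begin
          (a - c * r) * (reduced a c - others a)
            ≈⟨ solve 3 (λ s p q → s :* (p :- q) := s :* p :- s :* q) refl (a - c * r) _ _ ⟩
          (a - c * r) * reduced a c - (a - c * r) * others a
            ≈⟨ +-cong (sym (det-pencil a c)) (-‿cong (*-congʳ (+-congˡ (-‿cong (*-congˡ (sym largest-eigenvalue)))))) ⟩
          Det (pencil a c) - product (λ i → a - c * ev i)
            ≈⟨ +-congʳ (det-pencil-spectrum a c) ⟩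
          product (λ i → a - c * ev i) - product (λ i → a - c * ev i)
            ≈⟨ -‿inverseʳ _ ⟩
          0# ∎

      det-shifted-pencil-spectrum : ∀ a b c → Det (λ i j → pencil a c i j + b) ≈
        (a - c * r + ι (suc n) * b) * product (λ i → a - c * ev (suc i))
      det-shifted-pencil-spectrum a b c = trans (det-shifted-pencil a b c) (*-congˡ (reduced-spectrum a c))

-- The Laplacian characteristic polynomial of the corona

-- Difference m n e says that the integer e is m − n, by the sign of e.

data Difference (m n : ℕ) : ℤ → Set where
  nonnegative : ∀ k → m ≡ n ℕ.+ k → Difference m n (+ k)
  negative    : ∀ k → n ≡ m ℕ.+ suc k → Difference m n -[1+ k ]

difference-⊖ : ∀ m n → Difference m n (m ⊖ n)
difference-⊖ m       zero    = nonnegative m ≡.refl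
difference-⊖ zero    (suc n) = negative n ≡.refl
difference-⊖ (suc m) (suc n) rewrite ℤ.[1+m]⊖[1+n]≡m⊖n m n with m ⊖ n | difference-⊖ m n
... | _ | nonnegative k m≡n+k = nonnegative k (≡.cong suc m≡n+k)
... | _ | negative k n≡m+k    = negative k (≡.cong suc n≡m+k)

module CoronaSpectrum {o ℓ₁ ℓ₂ ℓ₃} (K : OrderedField o ℓ₁ ℓ₂ ℓ₃) where
  open OrderedField K using (_#_; _≤_; 0<1; commutativeRing)
  open Spectral ⦃ K ⦄ using (PowerDefined; power; AdjacencyEigenvalues; LaplacianEigenvalues)
  open CommutativeRing commutativeRing hiding (zero)
  open Matrices commutativeRing
  open IntegerSolver commutativeRing
  open Determinant commutativeRing
  open GraphSums commutativeRing
  open PolynomialFunctions commutativeRing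
  open OrderedFieldProperties K
  open Algebra.Properties.Semiring.Exp semiring using (^-homo-*)
  open Algebra.Properties.CommutativeSemiring.Exp commutativeSemiring using (^-distrib-*)
  open Relation.Binary.Reasoning.Setoid setoid

  product-^ : ∀ {n} (f : Fin n → Carrier) m → product f ^ m ≈ product (λ i → f i ^ m)
  product-^ {zero}  f zero    = refl
  product-^ {zero}  f (suc m) = trans (*-identityˡ _) (product-^ f m)
  product-^ {suc n} f m       = trans (^-distrib-* (f zero) _ m) (*-congˡ (product-^ (f ∘ suc) m))

  ^-cancel-0 : ∀ {y z} n → y # 0# → y ^ n * z ≈ 0# → z ≈ 0#
  ^-cancel-0 zero    y#0 h = trans (sym (*-identityˡ _)) h
  ^-cancel-0 (suc n) y#0 h = ^-cancel-0 n y#0 (*-cancel-0 y#0 (trans (sym (*-assoc _ _ _)) h))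

  ^-*-power : ∀ {m n e} → Difference m n e → ∀ y (d : PowerDefined y e) → y ^ n * power y e d ≈ y ^ m
  ^-*-power {n = n} (nonnegative k ≡.refl) y d   = sym (^-homo-* y n k)
  ^-*-power {m = m} (negative k ≡.refl) y y#0 = begin
    y ^ (m ℕ.+ suc k) * z ^ suc k      ≈⟨ *-congʳ (^-homo-* y m (suc k)) ⟩
    y ^ m * y ^ suc k * z ^ suc k      ≈⟨ *-assoc _ _ _ ⟩
    y ^ m * (y ^ suc k * z ^ suc k)    ≈⟨ *-congˡ (^-distrib-* y z (suc k)) ⟨
    y ^ m * (y * z) ^ suc k            ≈⟨ *-congˡ (^-cong (suc k) (trans (*-comm y z) (proj₂ (reciprocal y#0)))) ⟩
    y ^ m * 1# ^ suc k                 ≈⟨ *-congˡ (1^n≈1 (suc k)) ⟩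
    y ^ m * 1#                         ≈⟨ *-identityʳ _ ⟩
    y ^ m                              ∎
    where
    z : Carrier
    z = proj₁ (reciprocal y#0)
    1^n≈1 : ∀ n → 1# ^ n ≈ 1#
    1^n≈1 zero    = refl
    1^n≈1 (suc n) = trans (*-identityˡ _) (1^n≈1 n)

  module _ {n n₂} (r : ℕ) (G₁ : Graph (Fin (suc n))) (G₂ : Graph (Fin n₂)) (regular : Regular r G₁)
    (ev : Fin (suc n) → Carrier) (adjacencyEigenvalues : AdjacencyEigenvalues G₁ ev)
    (μ : Fin n₂ → Carrier) (laplacianEigenvalues : LaplacianEigenvalues G₂ μ) where

    private
      n₁ = suc n
      m₁ = size G₁
      A₁ = adjacency G₁

      -- the characteristic polynomial of the corona
      Φ : Carrier → Carrier
      Φ x = Det (λ i j → x * identity i j - laplacian (G₁ ⊡ G₂) i j)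

      P : Carrier → Matrix n₂
      P x i j = (x - ι 2) * identity i j - laplacian G₂ i j

    -- The factors of the characteristic polynomial: that of the eigenvalue r of
    -- G₁, those of the copies of G₂, and those of the other eigenvalues of G₁.

    mainFactor copiesFactor : Carrier → Carrier
    mainFactor x   = x ^ 2 - x * (ι n₂ * ι r + ι r + ι 2)
    copiesFactor x = product (λ j → (x - ι 2 - μ j) ^ m₁)

    eigenvalueFactor : Carrier → Fin n₁ → Carrier
    eigenvalueFactor x i =
      x ^ 2 - x * (ι 2 + ι n₁ + ι n₂ * ι r + ev i) + ι 2 * ι n₁ + ι n₂ * ι r - ι r + ev i - ι n₂ * ev i

    otherFactors : Carrier → Carrier
    otherFactors x = product (λ i → eigenvalueFactor x (suc i))

    private
      row-sums : ∀ v → ∑ (A₁ v) ≈ ι r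
      row-sums v = trans (sym (ι-degree G₁ v)) (reflexive (≡.cong ι (regular v)))

      column-sums : ∀ v → ∑ (λ u → A₁ u v) ≈ ι r
      column-sums v = trans (∑-cong λ u → reflexive (adjacency-sym G₁ u v)) (row-sums v)

      A₁-nonneg : ∀ u v → 0# ≤ A₁ u v
      A₁-nonneg u v = indicator-nonneg (adj G₁ u v)
        where
        indicator-nonneg : ∀ b → 0# ≤ indicator b
        indicator-nonneg true  = <⇒≤ 0<1
        indicator-nonneg false = 0≤0

      open ConstantSums A₁ (ι r) row-sums column-sums ev
        (λ x → trans (reflexive (Det≡det _)) (proj₁ adjacencyEigenvalues x))

    -- The main factor is a − c r + n₁ y, and the factor of the eigenvalue ev i is
    -- a − c ev i.

    det-vertices : ∀ x → let open Corona commutativeRing G₁ G₂ r regular x in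
      Det (λ u v → a * identity u v + (x - ι 2) - c * A₁ u v) ≈ mainFactor x * otherFactors x
    det-vertices x = begin
      Det (λ u v → a * identity u v + y - c * A₁ u v)
        ≈⟨ det-cong (λ u v → solve 3 (λ p y q → p :+ y :- q := p :- q :+ y) refl (a * identity u v) y (c * A₁ u v)) ⟩
      Det (λ u v → pencil a c u v + y)
        ≈⟨ det-shifted-pencil-spectrum A₁-nonneg (proj₂ adjacencyEigenvalues) a y c ⟩
      (a - c * ι r + ι n₁ * y) * product (λ i → a - c * ev (suc i))
        ≈⟨ *-cong (solve 4 (λ x n m r →
             let y = x :- con (+ 2); a = y :* (x :- n :- m :* r) :- (m :+ :1) :* r; c = y :+ m :+ :1 in
             a :- c :* r :+ n :* y := x :* (x :* :1) :- x :* (m :* r :+ r :+ con (+ 2)))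
             refl x (ι n₁) (ι n₂) (ι r))
           (product-cong {n} λ i → solve 5 (λ x n m r e →
             let y = x :- con (+ 2); a = y :* (x :- n :- m :* r) :- (m :+ :1) :* r; c = y :+ m :+ :1 in
             a :- c :* e := x :* (x :* :1) :- x :* (con (+ 2) :+ n :+ m :* r :+ e) :+ con (+ 2) :* n :+ m :* r :- r :+ e :- m :* e)
             refl x (ι n₁) (ι n₂) (ι r) (ev (suc i))) ⟩
      mainFactor x * otherFactors x ∎
      where
      open Corona commutativeRing G₁ G₂ r regular x
      y : Carrier
      y = x - ι 2

    det-copies : ∀ x → Det (P x) ^ m₁ ≈ copiesFactor x
    det-copies x = begin
      Det (P x) ^ m₁                          ≈⟨ ^-cong m₁ (trans (reflexive (Det≡det _)) (proj₁ laplacianEigenvalues (x - ι 2))) ⟩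
      product (λ j → x - ι 2 - μ j) ^ m₁      ≈⟨ product-^ (λ j → x - ι 2 - μ j) m₁ ⟩
      copiesFactor x                          ∎

    scaled-charPoly : ∀ x → (x - ι 2) ^ n₁ * Φ x ≈ (x - ι 2) ^ m₁ * (mainFactor x * copiesFactor x * otherFactors x)
    scaled-charPoly x = begin
      (x - ι 2) ^ n₁ * Φ x
        ≈⟨ Corona.corona-determinant commutativeRing G₁ G₂ r regular x ⟩
      Det _ * (x - ι 2) ^ m₁ * Det (P x) ^ m₁
        ≈⟨ *-cong (*-congʳ (det-vertices x)) (det-copies x) ⟩
      mainFactor x * otherFactors x * (x - ι 2) ^ m₁ * copiesFactor x
        ≈⟨ solve 4 (λ m o p c → m :* o :* p :* c := p :* (m :* c :* o)) refl _ _ _ _ ⟩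
      (x - ι 2) ^ m₁ * (mainFactor x * copiesFactor x * otherFactors x) ∎

    private
      -- the claimed value of Φ, up to the power of x − 2
      Ψ : Carrier → Carrier
      Ψ x = mainFactor x * copiesFactor x * otherFactors x

      scaled-difference : ∀ {e} → Difference m₁ n₁ e → ∀ x (d : PowerDefined (x - ι 2) e) →
                          (x - ι 2) ^ n₁ * (Φ x - power (x - ι 2) e d * Ψ x) ≈ 0#
      scaled-difference {e} m₁-n₁ x d = begin
        (x - ι 2) ^ n₁ * (Φ x - power (x - ι 2) e d * Ψ x)
          ≈⟨ solve 4 (λ y p q s → y :* (p :- q :* s) := y :* p :- y :* q :* s) refl _ _ _ _ ⟩
        (x - ι 2) ^ n₁ * Φ x - (x - ι 2) ^ n₁ * power (x - ι 2) e d * Ψ x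
          ≈⟨ +-cong (scaled-charPoly x) (-‿cong (*-congʳ (^-*-power m₁-n₁ (x - ι 2) d))) ⟩
        (x - ι 2) ^ m₁ * Ψ x - (x - ι 2) ^ m₁ * Ψ x
          ≈⟨ -‿inverseʳ _ ⟩
        0# ∎

      _-ᵖ_ : ∀ {F : Carrier → Carrier} → IsPolynomial F → ∀ a → IsPolynomial (λ x → F x - a)
      p -ᵖ a = polynomial-- p (polynomial-const a)

      _+ᵖ_ : ∀ {F : Carrier → Carrier} → IsPolynomial F → ∀ a → IsPolynomial (λ x → F x + a)
      p +ᵖ a = polynomial-+ p (polynomial-const a)

      quadratic : ∀ a → IsPolynomial (λ x → x ^ 2 - x * a)
      quadratic a = polynomial-- (polynomial-^ 2 polynomial-id) (polynomial-* polynomial-id (polynomial-const a))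

      Φ-polynomial : IsPolynomial Φ
      Φ-polynomial = polynomial-det λ i j → polynomial-* polynomial-id (polynomial-const _) -ᵖ _

      Ψ-polynomial : IsPolynomial Ψ
      Ψ-polynomial = polynomial-*
        (polynomial-* (quadratic _) (polynomial-product {F = λ x j → (x - ι 2 - μ j) ^ m₁} λ j → polynomial-^ m₁ ((polynomial-id -ᵖ ι 2) -ᵖ μ j)))
        (polynomial-product {F = λ x i → eigenvalueFactor x (suc i)} λ i → ((((quadratic _ +ᵖ _) +ᵖ _) -ᵖ _) +ᵖ _) -ᵖ _)

      Det-corona : ∀ {e} → Difference m₁ n₁ e → ∀ x (d : PowerDefined (x - ι 2) e) →
                   Φ x ≈ power (x - ι 2) e d * Ψ x
      Det-corona {e} m₁-n₁ x d = begin
        Φ x                           ≈⟨ solve 2 (λ p q → p := p :- q :+ q) refl (Φ x) Ψ′ ⟩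
        Φ x - Ψ′ + Ψ′                 ≈⟨ +-congʳ (difference≈0 m₁-n₁ d) ⟩
        0# + Ψ′                       ≈⟨ +-identityˡ _ ⟩
        Ψ′                            ∎
        where
        Ψ′ : Carrier
        Ψ′ = power (x - ι 2) e d * Ψ x
        difference≈0 : ∀ {e} → Difference m₁ n₁ e → (d : PowerDefined (x - ι 2) e) → Φ x - power (x - ι 2) e d * Ψ x ≈ 0#
        difference≈0 δ@(negative _ _) y#0 = ^-cancel-0 n₁ y#0 (scaled-difference δ x y#0)
        difference≈0 δ@(nonnegative k _) _ = cancel-linear-^ (ι 2) n₁
          (polynomial-- Φ-polynomial (polynomial-* (polynomial-^ k (polynomial-id -ᵖ ι 2)) Ψ-polynomial))
          (λ t → scaled-difference δ t _) x

    charPoly-corona : ∀ x (d : PowerDefined (x - ι 2) (m₁ ⊖ n₁)) →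
      charPoly (laplacian (G₁ ⊡ G₂)) x ≈
      power (x - ι 2) (m₁ ⊖ n₁) d * mainFactor x * copiesFactor x * otherFactors x
    charPoly-corona x d = begin
      charPoly (laplacian (G₁ ⊡ G₂)) x
        ≡⟨ Det≡det _ ⟨
      Φ x
        ≈⟨ Det-corona (difference-⊖ m₁ n₁) x d ⟩
      p * (mainFactor x * copiesFactor x * otherFactors x)
        ≈⟨ *-assoc _ _ _ ⟨
      p * (mainFactor x * copiesFactor x) * otherFactors x
        ≈⟨ *-congʳ (*-assoc _ _ _) ⟨
      p * mainFactor x * copiesFactor x * otherFactors x ∎
      where
      p : Carrier
      p = power (x - ι 2) (m₁ ⊖ n₁) d

open Spectral

theorem5p6 : ∀ {c ℓ₁ ℓ₂ ℓ₃} ⦃ K : OrderedField c ℓ₁ ℓ₂ ℓ₃ ⦄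
    (n₁ n₂ r₁ : ℕ) (G₁ : Graph (Fin n₁)) (G₂ : Graph (Fin n₂)) →
    Connected G₁ → Connected G₂ → Regular r₁ G₁ →
    (λ₁ : Fin n₁ → Carrier) → AdjacencyEigenvalues G₁ λ₁ →
    (μ₂ : Fin n₂ → Carrier) → LaplacianEigenvalues G₂ μ₂ →
    let m₁ = size G₁ in
    (x : Carrier) (d : PowerDefined (x - ι 2) (m₁ ⊖ n₁)) →
    charPoly (laplacian (G₁ ⊡ G₂)) x
    ≈ power (x - ι 2) (m₁ ⊖ n₁) d
    * (x ^ 2 - x * (ι n₂ * ι r₁ + ι r₁ + ι 2))
    * product (λ j → (x - ι 2 - μ₂ j) ^ m₁)
    * productFrom2 (λ i →
    x ^ 2 - x * (ι 2 + ι n₁ + ι n₂ * ι r₁ + λ₁ i)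
    + ι 2 * ι n₁ + ι n₂ * ι r₁ - ι r₁ + λ₁ i - ι n₂ * λ₁ i)
theorem5p6 zero n₂ r₁ G₁ G₂ (() , _)
theorem5p6 ⦃ K ⦄ (suc n) n₂ r₁ G₁ G₂ _ _ regular λ₁ isλ₁ μ₂ isμ₂ =
  CoronaSpectrum.charPoly-corona K r₁ G₁ G₂ regular λ₁ isλ₁ μ₂ isμ₂
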